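{- Let $G$ be a subcubic graph. 1. If $\mathrm{mad}(G)<\frac{7}{3}$, then $\chi'_{\mathrm{inj}}(G)\leq 4$. 2. If $\mathrm{mad}(G)<\frac{8}{3}$, then $\chi'_{\mathrm{inj}}(G)\leq 6$. 3. If $\mathrm{mad}(G)<3$, then $\chi'_{\mathrm{inj}}(G)\leq 7$.
   Context: All graphs are finite and simple. A graph is subcubic if its maximum degree is at most $3$. The maximum average degree of $G$ is $\mathrm{mad}(G)=\max\left\{\frac{2|E(H)|}{|V(H)|} : H\subseteq G\right\}$, the maximum being over the (nonempty) subgraphs $H$ of $G$. Three edges $e_1,e_2,e_3$ of a graph are consecutive if they form (in this order) a path of length three or a cycle of length three. An injective edge-coloring of $G$ with $k$ colors is a map $c:E(G)\to\{1,\dots,k\}$ (not necessarily a proper edge-coloring) such that $c(e_1)\neq c(e_3)$ whenever $e_1,e_2,e_3$ are consecutive edges in $G$. The injective chromatic index $\chi'_{\mathrm{inj}}(G)$ is the minimum $k$ such that $G$ has an injective edge-coloring with $k$ colors. -}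

module Defs where

open import Data.Fin.Base using (Fin; finToFun; funToFin)
import Data.Fin.Base as Fin
import Data.Fin.Properties as Fin
open import Data.Fin.Subset using (Subset; inside; outside; _∈_; ∣_∣; ⊤)
open import Data.Fin.Subset.Properties using (_∈?_; ∈⊤; ∣⊤∣≡n)
open import Data.Integer.Base using (+_)
open import Data.List.Base
  using (List; []; _∷_; _++_; map; mapMaybe; filter; length; lookup; allFin; cartesianProduct)
import Data.List.Extrema
import Data.List.Extrema.Nat as ℕ-Extrema
open import Data.List.Membership.Propositional using () renaming (_∈_ to _∈ₗ_)
open import Data.List.Membership.Propositional.Properties
  using (∈-++⁺ˡ; ∈-++⁺ʳ; ∈-map⁺; ∈-map⁻; ∈-cartesianProduct⁺)
import Data.List.Relation.Unary.All as All
open import Data.List.Relation.Unary.AllPairs using (_∷_)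
open import Data.List.Relation.Unary.Any using (here; there)
open import Data.List.Relation.Unary.Unique.Propositional using (Unique)
open import Data.Maybe.Base using (Maybe; just; nothing)
open import Data.Nat.Base using (ℕ; zero; suc; z≤n; s≤s; _≤_; _*_; NonZero)
import Data.Nat.Properties as ℕ
open import Data.Product.Base using (∃; ∃-syntax; _×_; _,_; proj₁; proj₂)
open import Data.Product.Properties using (≡-dec)
open import Data.Rational.Base using (ℚ; 0ℚ; _/_)
import Data.Rational.Base as ℚ
import Data.Rational.Properties as ℚ
open import Data.Sum.Base using (_⊎_; inj₁; inj₂)
open import Data.Vec.Base using ([]; _∷_)
open import Function.Base using (_∘_; id)
open import Level using (0ℓ)
open import Relation.Binary.Bundles using (DecTotalOrder)
open import Relation.Binary.Core using (Rel)
open import Relation.Binary.Definitions using (Symmetric; Irreflexive)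
  renaming (Decidable to Decidable₂)
open import Relation.Binary.PropositionalEquality
  using (_≡_; _≢_; refl; sym; trans; subst)
open import Relation.Nullary using (¬_; Dec; yes; no; contradiction)
open import Relation.Nullary.Decidable using (map′; _×-dec_; _⊎-dec_; _→-dec_; ¬?)
open import Relation.Unary using (Pred; Decidable)

module ℚ-Extrema = Data.List.Extrema (DecTotalOrder.totalOrder ℚ.≤-decTotalOrder)

record Graph : Set₁ where
  field
    n          : ℕ
    Adj        : Rel (Fin n) 0ℓ
    adj?       : Decidable₂ Adj
    adj-sym    : Symmetric Adj
    adj-irrefl : Irreflexive _≡_ Adj

  Vertex : Set
  Vertex = Fin n

  -- Every edge is listed exactly once, as the pair of its ends in
  -- increasing order.
  edges : List (Vertex × Vertex)
  edges = filter (λ (u , v) → (u Fin.<? v) ×-dec adj? u v)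
                 (cartesianProduct (allFin n) (allFin n))

  ∣E∣ : ℕ
  ∣E∣ = length edges

  Edge : Set
  Edge = Fin ∣E∣

  ends : Edge → Vertex × Vertex
  ends = lookup edges

  Joins : Edge → Vertex → Vertex → Set
  Joins e u v = ends e ≡ (u , v) ⊎ ends e ≡ (v , u)

  degree : Vertex → ℕ
  degree v = length (filter (adj? v) (allFin n))

  maxDegree : ℕ
  maxDegree = ℕ-Extrema.max 0 (map degree (allFin n))

open Graph

Subcubic : Graph → Set
Subcubic G = maxDegree G ≤ 3

IsSubgraph : (G : Graph) → Subset (n G) → Subset (∣E∣ G) → Set
IsSubgraph G V E = ∀ e → e ∈ E → proj₁ (ends G e) ∈ V × proj₂ (ends G e) ∈ V

record Subgraph (G : Graph) : Set where
  constructor subgraph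
  field
    V            : Subset (n G)
    E            : Subset (∣E∣ G)
    {{nonempty}} : NonZero ∣ V ∣
    isSubgraph   : IsSubgraph G V E

  averageDegree : ℚ
  averageDegree = + (2 * ∣ E ∣) / ∣ V ∣

open Subgraph using (averageDegree)

subsets : ∀ m → List (Subset m)
subsets zero    = [] ∷ []
subsets (suc m) = map (inside ∷_) (subsets m) ++ map (outside ∷_) (subsets m)

isSubgraph? : ∀ G V E → Dec (IsSubgraph G V E)
isSubgraph? G V E = Fin.all? λ e →
  (e ∈? E) →-dec ((proj₁ (ends G e) ∈? V) ×-dec (proj₂ (ends G e) ∈? V))

toSubgraph : ∀ G → Subset (n G) × Subset (∣E∣ G) → Maybe (Subgraph G)
toSubgraph G (V , E) with ℕ.nonZero? ∣ V ∣ | isSubgraph? G V E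
... | yes V≢∅ | yes sub = just (subgraph V E {{V≢∅}} sub)
... | yes _   | no  _   = nothing
... | no  _   | _       = nothing

subgraphs : ∀ G → List (Subgraph G)
subgraphs G = mapMaybe (toSubgraph G) (cartesianProduct (subsets (n G)) (subsets (∣E∣ G)))

-- Average degrees are nonnegative, so the base value 0 only matters for the
-- graph without vertices, which has no nonempty subgraph; see mad-upper and
-- mad-attained below.
mad : Graph → ℚ
mad G = ℚ-Extrema.max 0ℚ (map averageDegree (subgraphs G))

-- a, b, c, d are the successive vertices of the path, or of the cycle when
-- d is a again.
Consecutive : (G : Graph) → (e₁ e₂ e₃ : Edge G) → Set
Consecutive G e₁ e₂ e₃ = ∃[ a ] ∃[ b ] ∃[ c ] ∃[ d ]
  Joins G e₁ a b × Joins G e₂ b c × Joins G e₃ c d ×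
  (Unique (a ∷ b ∷ c ∷ d ∷ []) ⊎ (Unique (a ∷ b ∷ c ∷ []) × d ≡ a))

IsInjectiveColoring : (G : Graph) {k : ℕ} → (Edge G → Fin k) → Set
IsInjectiveColoring G c = ∀ e₁ e₂ e₃ → Consecutive G e₁ e₂ e₃ → c e₁ ≢ c e₃

InjectivelyColorable : Graph → ℕ → Set
InjectivelyColorable G k = ∃[ c ] IsInjectiveColoring G {k} c

joins? : ∀ G e u v → Dec (Joins G e u v)
joins? G e u v = (ends G e ≟ (u , v)) ⊎-dec (ends G e ≟ (v , u))
  where _≟_ = ≡-dec Fin._≟_ Fin._≟_

consecutive? : ∀ G e₁ e₂ e₃ → Dec (Consecutive G e₁ e₂ e₃)
consecutive? G e₁ e₂ e₃ =
  Fin.any? λ a → Fin.any? λ b → Fin.any? λ c → Fin.any? λ d →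
    joins? G e₁ a b ×-dec joins? G e₂ b c ×-dec joins? G e₃ c d ×-dec
    (unique? (a ∷ b ∷ c ∷ d ∷ []) ⊎-dec
      (unique? (a ∷ b ∷ c ∷ []) ×-dec (d Fin.≟ a)))
  where open import Data.List.Relation.Unary.Unique.DecPropositional (Fin._≟_ {n G})
          using (unique?)

isInjectiveColoring? : ∀ G {k} → Decidable (IsInjectiveColoring G {k})
isInjectiveColoring? G c = Fin.all? λ e₁ → Fin.all? λ e₂ → Fin.all? λ e₃ →
  consecutive? G e₁ e₂ e₃ →-dec ¬? (c e₁ Fin.≟ c e₃)

injectivelyColorable? : ∀ G → Decidable (InjectivelyColorable G)
injectivelyColorable? G k = map′
  (λ (i , ok) → finToFun i , ok)
  (λ (c , ok) → funToFin c , λ e₁ e₂ e₃ con eq → ok e₁ e₂ e₃ con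
     (trans (sym (Fin.finToFun-funToFin c e₁)) (trans eq (Fin.finToFun-funToFin c e₃))))
  (Fin.any? (λ i → isInjectiveColoring? G (finToFun i)))

consecutive⇒≢ : ∀ G {e₁ e₂ e₃} → Consecutive G e₁ e₂ e₃ → e₁ ≢ e₃
consecutive⇒≢ G (a , b , c , d , p , _ , q , s) refl = go p q s
  where
  go : ∀ {x} → x ≡ (a , b) ⊎ x ≡ (b , a) → x ≡ (c , d) ⊎ x ≡ (d , c) →
       ¬ (Unique (a ∷ b ∷ c ∷ d ∷ []) ⊎ (Unique (a ∷ b ∷ c ∷ []) × d ≡ a))
  go (inj₁ refl) (inj₁ refl) (inj₁ ((_ All.∷ a≢c All.∷ _) ∷ _))       = a≢c refl
  go (inj₁ refl) (inj₁ refl) (inj₂ ((_ All.∷ a≢c All.∷ _) ∷ _ , _))   = a≢c refl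
  go (inj₁ refl) (inj₂ refl) (inj₁ (_ ∷ (b≢c All.∷ _) ∷ _))           = b≢c refl
  go (inj₁ refl) (inj₂ refl) (inj₂ (_ ∷ (b≢c All.∷ _) ∷ _ , _))       = b≢c refl
  go (inj₂ refl) (inj₁ refl) (inj₁ (_ ∷ (b≢c All.∷ _) ∷ _))           = b≢c refl
  go (inj₂ refl) (inj₁ refl) (inj₂ (_ ∷ (b≢c All.∷ _) ∷ _ , _))       = b≢c refl
  go (inj₂ refl) (inj₂ refl) (inj₁ ((_ All.∷ a≢c All.∷ _) ∷ _))       = a≢c refl
  go (inj₂ refl) (inj₂ refl) (inj₂ ((_ All.∷ a≢c All.∷ _) ∷ _ , _))   = a≢c refl

∣E∣-colorable : ∀ G → InjectivelyColorable G (∣E∣ G)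
∣E∣-colorable G = id , λ _ _ _ → consecutive⇒≢ G

IsMinimum : Pred ℕ 0ℓ → Pred ℕ 0ℓ
IsMinimum P k = P k × (∀ j → P j → k ≤ j)

minimum : ∀ {P : Pred ℕ 0ℓ} → Decidable P → ∀ k → P k → ∃ (IsMinimum P)
minimum P? zero    p = zero , p , λ _ _ → z≤n
minimum {P} P? (suc k) p with P? zero
... | yes p₀ = zero , p₀ , λ _ _ → z≤n
... | no ¬p₀ with minimum (P? ∘ suc) k p
...   | m , pm , least = suc m , pm , bound
  where
  bound : ∀ j → P j → suc m ≤ j
  bound zero    p₀ = contradiction p₀ ¬p₀
  bound (suc j) pj = s≤s (least j pj)

injectiveChromaticIndex : ∀ G → ∃ (IsMinimum (InjectivelyColorable G))
injectiveChromaticIndex G = minimum (injectivelyColorable? G) (∣E∣ G) (∣E∣-colorable G)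

χ′inj : Graph → ℕ
χ′inj G = proj₁ (injectiveChromaticIndex G)

χ′inj-isMinimum : ∀ G → IsMinimum (InjectivelyColorable G) (χ′inj G)
χ′inj-isMinimum G = proj₂ (injectiveChromaticIndex G)

subsets-complete : ∀ {m} (S : Subset m) → S ∈ₗ subsets m
subsets-complete []            = here refl
subsets-complete (inside  ∷ S) = ∈-++⁺ˡ (∈-map⁺ (inside ∷_) (subsets-complete S))
subsets-complete (outside ∷ S) =
  ∈-++⁺ʳ (map (inside ∷_) (subsets _)) (∈-map⁺ (outside ∷_) (subsets-complete S))

toSubgraph-complete : ∀ G V E → NonZero ∣ V ∣ → IsSubgraph G V E →
  ∃[ V≢∅ ] ∃[ sub ] toSubgraph G (V , E) ≡ just (subgraph V E {{V≢∅}} sub)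
toSubgraph-complete G V E V≢∅ sub with ℕ.nonZero? ∣ V ∣ | isSubgraph? G V E
... | yes _   | yes _    = _ , _ , refl
... | yes _   | no ¬sub  = contradiction sub ¬sub
... | no V≡∅  | _        = contradiction V≢∅ V≡∅

∈-mapMaybe⁺ : ∀ {A B : Set} (f : A → Maybe B) {x y xs} →
              x ∈ₗ xs → f x ≡ just y → y ∈ₗ mapMaybe f xs
∈-mapMaybe⁺ f (here refl) eq rewrite eq = here refl
∈-mapMaybe⁺ f {xs = x ∷ _} (there x∈xs) eq with f x
... | just _  = there (∈-mapMaybe⁺ f x∈xs eq)
... | nothing = ∈-mapMaybe⁺ f x∈xs eq

averageDegree-listed : ∀ {G} (H : Subgraph G) →
                       averageDegree H ∈ₗ map averageDegree (subgraphs G)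
averageDegree-listed {G} (subgraph V E {{V≢∅}} sub) =
  let _ , _ , eq = toSubgraph-complete G V E V≢∅ sub in
  ∈-map⁺ averageDegree (∈-mapMaybe⁺ (toSubgraph G)
    (∈-cartesianProduct⁺ (subsets-complete V) (subsets-complete E)) eq)

mad-upper : ∀ {G} (H : Subgraph G) → averageDegree H ℚ.≤ mad G
mad-upper {G} H = All.lookup (ℚ-Extrema.xs≤max 0ℚ (map averageDegree (subgraphs G)))
                             (averageDegree-listed H)

averageDegree-nonNeg : ∀ {G} (H : Subgraph G) → 0ℚ ℚ.≤ averageDegree H
averageDegree-nonNeg (subgraph V E _) =
  ℚ.nonNegative⁻¹ _ {{ℚ.normalize-nonNeg (2 * ∣ E ∣) ∣ V ∣}}

mad-attained : ∀ G {{_ : NonZero (n G)}} → ∃[ H ] averageDegree {G} H ≡ mad G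
mad-attained G {{n≢0}} = attained (ℚ-Extrema.argmax-sel id 0ℚ densities)
  where
  densities : List ℚ
  densities = map averageDegree (subgraphs G)

  whole : Subgraph G
  whole = subgraph ⊤ ⊤ {{subst NonZero (sym (∣⊤∣≡n (n G))) n≢0}} (λ _ _ → ∈⊤ , ∈⊤)

  attained : mad G ≡ 0ℚ ⊎ mad G ∈ₗ densities → ∃[ H ] averageDegree {G} H ≡ mad G
  attained (inj₁ mad≡0) = whole , ℚ.≤-antisym (mad-upper whole)
    (subst (ℚ._≤ averageDegree whole) (sym mad≡0) (averageDegree-nonNeg whole))
  attained (inj₂ mad∈) = let H , _ , eq = ∈-map⁻ averageDegree mad∈ in H , sym eq

{-# OPTIONS --safe #-}
-- Everything happens in induced subgraphs S of G, which inherit the bound on the average degree.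
-- By discharging, every nonempty S contains a configuration that can be deleted and whose edges
-- can be colored back, so that there is no minimal counterexample.  The induction runs under a
-- double negation, which is harmless since injective colorability is decidable.
--
-- With 7 and 6 colors the deleted edges are colored greedily.  A density below 3 gives a vertex
-- of degree at most 2; below 8/3 there is a vertex of degree at most 1, two adjacent 2-vertices or
-- a 3-vertex with two 2-neighbors, since otherwise each 2-vertex could take 1/3 from both neighbors.
--
-- With 4 colors a leaf can be impossible to color greedily.  Therefore every vertex of degree at
-- most 2 is given one more, virtual, pendant edge; this strengthens the induction, because
-- deleting T leaves at each boundary vertex a color in reserve for the edges towards T.  The
-- configurations are a vertex of degree at most 1, a triangle with two 2-vertices, a path of
-- three 2-vertices and a spider: a 3-vertex with three 2-neighbors, two of which have a second
-- 2-neighbor.  That they can be recolored under every boundary condition is a finite check.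
-- Without them, each 2-vertex takes 1/6 from the 3-vertex at either end of its chain of
-- 2-vertices, and a 3-vertex pays at most 4 times.

module Submission where

open import Defs using (Graph; Subcubic; mad; χ′inj)
open import Data.Integer.Base using (+_)
open import Data.Nat.Base using (_≤_)
open import Data.Product.Base using (_×_)
open import Data.Rational.Base using (_<_; _/_)

open import Data.Bool.Base using (Bool; true; false; T; not; _∧_; _∨_; if_then_else_)
open import Data.Bool.ListAction using (all; any)
open import Data.Bool.Properties using (T-∧; T-≡; T?)
open import Data.Empty using (⊥)
open import Data.Fin.Base as Fin using (Fin; zero; suc; toℕ)
open import Data.Fin.Patterns using (0F; 1F; 2F; 3F; 4F; 5F)
import Data.Fin.Properties as Fin
open import Data.Fin.Subset using (Subset; inside; outside; ∣_∣; ⊤; _⊂_)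
  renaming (_∈_ to _∈ˢ_; _∉_ to _∉ˢ_)
open import Data.Fin.Subset.Induction using (⊂-wellFounded)
open import Data.Fin.Subset.Properties using (nonempty?; x∈p⇒∣p-x∣<∣p∣; ∈⊤)
  renaming (_∈?_ to _∈ˢ?_)
import Data.Integer.Base as ℤ
import Data.Integer.Properties as ℤ
open import Data.List.Base as List
  using (List; []; _∷_; map; filterᵇ; filter; allFin; cartesianProduct; length)
import Data.List.Extrema.Nat as ℕ-Extrema
open import Data.List.Membership.Propositional using (_∈_; _∉_; find)
open import Data.List.Membership.Propositional.Properties
  using (∈-allFin; ∈-cartesianProduct⁺; ∈-map⁺; ∈-filter⁻; ∈-filter⁺; ∈-lookup; ∈-++⁺ˡ; ∈-++⁺ʳ)
import Data.List.Properties as List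
open import Data.List.Relation.Unary.All as All using (All; []; _∷_)
import Data.List.Relation.Unary.All.Properties as All
open import Data.List.Relation.Unary.Any as Any using (Any; here; there)
import Data.List.Relation.Unary.Any.Properties as Any
open import Data.List.Relation.Unary.Unique.Propositional using (Unique; []; _∷_)
import Data.List.Relation.Unary.Unique.Propositional.Properties as Unique
open import Data.Maybe.Base as Maybe using (Maybe; just; nothing)
open import Data.Nat.Base as ℕ using (ℕ; zero; suc; _+_; _*_; z≤n; s≤s; NonZero)
import Data.Nat.ListAction as ListAction
import Data.Nat.Properties as ℕ
open import Data.Product.Base using (_,_; ∃-syntax; proj₁; proj₂)
import Data.Rational.Properties as ℚ
open import Data.Rational.Unnormalised.Base using (mkℚᵘ)
import Data.Rational.Unnormalised.Properties as ℚᵘ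
open import Data.Sum.Base using (_⊎_; inj₁; inj₂; [_,_]′; map₂; swap)
import Data.Vec.Base as Vec
import Data.Vec.Properties as Vec
open import Function.Base using (_∘_; id; case_of_)
open import Function.Bundles using (Equivalence)
import Induction.WellFounded as WF
open import Relation.Binary.Definitions using (tri<; tri≈; tri>)
open import Relation.Binary.PropositionalEquality
  using (_≡_; _≢_; refl; sym; trans; cong; cong₂; subst; subst₂; module ≡-Reasoning)
open import Relation.Nullary
  using (¬_; Dec; yes; no; does; proof; contradiction; Reflects; invert)
open import Relation.Nullary.Decidable
  using (toWitness; _×-dec_; _⊎-dec_; ¬?; dec-true; dec-false; decidable-stable)

open import Algebra.Properties.CommutativeMonoid.Sum ℕ.+-0-commutativeMonoid
  using (sum; ∑-comm; ∑-distrib-+; sum-cong-≗)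
open import Data.List.Membership.DecPropositional (Fin._≟_ {4})
  using () renaming (_∈?_ to _∈ᶜ?_)
open import Defs using (subgraph; InjectivelyColorable; Consecutive; injectivelyColorable?;
  χ′inj-isMinimum; mad-upper)

-- Finite sums and counting

𝟙 : ∀ {P : Set} → Dec P → ℕ
𝟙 d = if does d then 1 else 0

𝟙-yes : ∀ {P : Set} (d : Dec P) → P → 𝟙 d ≡ 1
𝟙-yes (yes _) p = refl
𝟙-yes (no ¬p) p = contradiction p ¬p

𝟙-no : ∀ {P : Set} (d : Dec P) → ¬ P → 𝟙 d ≡ 0
𝟙-no (yes p) ¬p = contradiction p ¬p
𝟙-no (no _)  ¬p = refl

𝟙-⇔ : ∀ {P Q : Set} (d : Dec P) (e : Dec Q) → (P → Q) → (Q → P) → 𝟙 d ≡ 𝟙 e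
𝟙-⇔ (yes p) e f g = sym (𝟙-yes e (f p))
𝟙-⇔ (no ¬p) e f g = sym (𝟙-no e (¬p ∘ g))

weight : ∀ {A : Set} → List A → (A → ℕ) → ℕ
weight xs f = ListAction.sum (map f xs)

module _ {A : Set} where

  weight-1 : (xs : List A) → length xs ≡ weight xs (λ _ → 1)
  weight-1 []       = refl
  weight-1 (x ∷ xs) = cong suc (weight-1 xs)

  weight-++ : ∀ (xs : List A) {ys} f → weight (xs List.++ ys) f ≡ weight xs f + weight ys f
  weight-++ []       f = refl
  weight-++ (x ∷ xs) f = trans (cong₂ _+_ {f x} refl (weight-++ xs f)) (sym (ℕ.+-assoc (f x) _ _))

  weight-map : ∀ {B : Set} (h : B → A) xs f → weight (map h xs) f ≡ weight xs (f ∘ h)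
  weight-map h []       f = refl
  weight-map h (x ∷ xs) f = cong₂ _+_ {f (h x)} refl (weight-map h xs f)

  weight-filter : ∀ {P : A → Set} (P? : ∀ x → Dec (P x)) xs f →
                  weight (filter P? xs) f ≡ weight xs (λ x → 𝟙 (P? x) * f x)
  weight-filter P? []       f = refl
  weight-filter P? (x ∷ xs) f with P? x
  ... | yes _ = cong₂ _+_ (sym (ℕ.*-identityˡ (f x))) (weight-filter P? xs f)
  ... | no  _ = weight-filter P? xs f

  weight-lookup : ∀ (xs : List A) f → sum (f ∘ List.lookup xs) ≡ weight xs f
  weight-lookup []       f = refl
  weight-lookup (x ∷ xs) f = cong₂ _+_ {f x} refl (weight-lookup xs f)

weight-× : ∀ {A B : Set} (xs : List A) (ys : List B) f →
           weight (cartesianProduct xs ys) f ≡ weight xs (λ x → weight ys (λ y → f (x , y)))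
weight-× []       ys f = refl
weight-× (x ∷ xs) ys f = trans (weight-++ (map (x ,_) ys) f)
                               (cong₂ _+_ (weight-map (x ,_) ys f) (weight-× xs ys f))

weight-tabulate : ∀ {A : Set} {n} (h : Fin n → A) f → weight (List.tabulate h) f ≡ sum (f ∘ h)
weight-tabulate {n = zero}  h f = refl
weight-tabulate {n = suc n} h f = cong₂ _+_ {f (h zero)} refl (weight-tabulate (h ∘ suc) f)

weight-allFin : ∀ n f → weight (allFin n) f ≡ sum f
weight-allFin n f = weight-tabulate id f

sum-mono : ∀ {n} {f g : Fin n → ℕ} → (∀ i → f i ≤ g i) → sum f ≤ sum g
sum-mono {zero}  f≤g = z≤n
sum-mono {suc n} f≤g = ℕ.+-mono-≤ (f≤g zero) (sum-mono (f≤g ∘ suc))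

sum-*ˡ : ∀ {n} c (f : Fin n → ℕ) → sum (λ i → c * f i) ≡ c * sum f
sum-*ˡ {zero}  c f = sym (ℕ.*-zeroʳ c)
sum-*ˡ {suc n} c f = trans (cong₂ _+_ {c * f zero} refl (sum-*ˡ c (f ∘ suc)))
                             (sym (ℕ.*-distribˡ-+ c (f zero) _))

∣∣≡sum : ∀ {n} (S : Subset n) → ∣ S ∣ ≡ sum (λ v → 𝟙 (v ∈ˢ? S))
∣∣≡sum Vec.[]              = refl
∣∣≡sum (inside  Vec.∷ S) = cong suc (trans (∣∣≡sum S) (sum-cong-≗ λ v →
  𝟙-⇔ (v ∈ˢ? S) (suc v ∈ˢ? (inside Vec.∷ S)) Vec.there λ { (Vec.there v∈) → v∈ }))
∣∣≡sum (outside Vec.∷ S) = trans (∣∣≡sum S) (sum-cong-≗ λ v →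
  𝟙-⇔ (v ∈ˢ? S) (suc v ∈ˢ? (outside Vec.∷ S)) Vec.there λ { (Vec.there v∈) → v∈ })

module _ {n : ℕ} {P : Fin n → Set} (P? : ∀ x → Dec (P x)) where

  comprehension : Subset n
  comprehension = Vec.tabulate (λ x → does (P? x))

  ∈-comprehension⁺ : ∀ {x} → P x → x ∈ˢ comprehension
  ∈-comprehension⁺ {x} p =
    Vec.lookup⇒[]= x _ (trans (Vec.lookup∘tabulate _ x) (dec-true (P? x) p))

  ∈-comprehension⁻ : ∀ {x} → x ∈ˢ comprehension → P x
  ∈-comprehension⁻ {x} x∈ =
    invert (subst (Reflects (P x))
      (trans (sym (Vec.lookup∘tabulate _ x)) (Vec.[]=⇒lookup x∈)) (proof (P? x)))

  ∣comprehension∣ : ∣ comprehension ∣ ≡ sum (λ x → 𝟙 (P? x))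
  ∣comprehension∣ = trans (∣∣≡sum comprehension) (sum-cong-≗ λ x →
    𝟙-⇔ (x ∈ˢ? comprehension) (P? x) ∈-comprehension⁻ ∈-comprehension⁺)

-- Fractions `a / b` are normalized by their gcd, so the comparison is moved to unnormalised
-- rationals, where the order is cross-multiplication by definition.
/-cancel-< : ∀ a b c d {{_ : NonZero b}} {{_ : NonZero d}} → + a / b < + c / d → a * d ℕ.< c * b
/-cancel-< a (suc b) c (suc d) a/b<c/d =
  ℤ.drop‿+<+ (subst₂ ℤ._<_ (sym (ℤ.pos-* a (suc d))) (sym (ℤ.pos-* c (suc b))) (ℚᵘ.drop-*<*
    (ℚᵘ.<-respˡ-≃ (ℚ.toℚᵘ-fromℚᵘ (mkℚᵘ (+ a) b)) (ℚᵘ.<-respʳ-≃ (ℚ.toℚᵘ-fromℚᵘ (mkℚᵘ (+ c) d))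
      (ℚ.toℚᵘ-mono-< a/b<c/d)))))

-- Induced subgraphs and discharging

module _ {A : Set} {P Q : A → Set} (P? : ∀ x → Dec (P x)) (Q? : ∀ x → Dec (Q x))
         (P⇒Q : ∀ {x} → P x → Q x) where

  filter-mono : ∀ xs → length (filter P? xs) ≤ length (filter Q? xs)
  filter-mono []       = z≤n
  filter-mono (x ∷ xs) with P? x | Q? x
  ... | yes _ | yes _ = s≤s (filter-mono xs)
  ... | yes p | no ¬q = contradiction (P⇒Q p) ¬q
  ... | no  _ | yes _ = ℕ.m≤n⇒m≤1+n (filter-mono xs)
  ... | no  _ | no  _ = filter-mono xs

  filter-mono-< : ∀ {xs x} → x ∈ xs → Q x → ¬ P x → length (filter P? xs) ℕ.< length (filter Q? xs)
  filter-mono-< {x ∷ xs} (here refl) q ¬p with P? x | Q? x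
  ... | yes p | _     = contradiction p ¬p
  ... | no  _ | yes _ = s≤s (filter-mono xs)
  ... | no  _ | no ¬q = contradiction q ¬q
  filter-mono-< {y ∷ xs} (there x∈) q ¬p with P? y | Q? y
  ... | yes _ | yes _ = s≤s (filter-mono-< x∈ q ¬p)
  ... | yes p | no ¬q = contradiction (P⇒Q p) ¬q
  ... | no  _ | yes _ = ℕ.m≤n⇒m≤1+n (filter-mono-< x∈ q ¬p)
  ... | no  _ | no  _ = filter-mono-< x∈ q ¬p

module Induced (G : Graph) where

  open Graph G

  infix 4 _⊢_~_

  -- An induced subgraph is a set of vertices of `G` with this relation. It is never rebuilt as a
  -- `Graph`, so vertices keep their names when others are deleted.
  _⊢_~_ : Subset n → Vertex → Vertex → Set
  S ⊢ u ~ v = u ∈ˢ S × v ∈ˢ S × Adj u v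

  joined? : ∀ S u v → Dec (S ⊢ u ~ v)
  joined? S u v = (u ∈ˢ? S) ×-dec (v ∈ˢ? S) ×-dec adj? u v

  ~-sym : ∀ {S u v} → S ⊢ u ~ v → S ⊢ v ~ u
  ~-sym (u∈ , v∈ , uv) = v∈ , u∈ , adj-sym uv

  ~-≢ : ∀ {S u v} → S ⊢ u ~ v → u ≢ v
  ~-≢ (_ , _ , uv) u≡v = adj-irrefl u≡v uv

  N : Subset n → Vertex → List Vertex
  N S v = filter (joined? S v) (allFin n)

  deg : Subset n → Vertex → ℕ
  deg S v = length (N S v)

  ∈-N⁺ : ∀ {S u v} → S ⊢ u ~ v → v ∈ N S u
  ∈-N⁺ {S} {u} {v} uv = ∈-filter⁺ (joined? S u) (∈-allFin v) uv

  ∈-N⁻ : ∀ {S u v} → v ∈ N S u → S ⊢ u ~ v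
  ∈-N⁻ {S} {u} v∈ = proj₂ (∈-filter⁻ (joined? S u) {xs = allFin n} v∈)

  N-unique : ∀ S v → Unique (N S v)
  N-unique S v = Unique.filter⁺ (joined? S v) (Unique.allFin⁺ n)

  weight-N : ∀ S v f → weight (N S v) f ≡ sum (λ u → 𝟙 (joined? S v u) * f u)
  weight-N S v f = trans (weight-filter (joined? S v) (allFin n) f) (weight-allFin n _)

  deg≡sum : ∀ S v → deg S v ≡ sum (λ u → 𝟙 (joined? S v u))
  deg≡sum S v = trans (weight-1 (N S v)) (trans (weight-N S v (λ _ → 1))
    (sum-cong-≗ (λ u → ℕ.*-identityʳ (𝟙 (joined? S v u)))))

  -- All charge sent is received: the two sums over ordered adjacent pairs are interchanged, and
  -- adjacency is symmetric.
  double-counting : ∀ S (g : Vertex → Vertex → ℕ) →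
    sum (λ v → weight (N S v) (g v)) ≡ sum (λ v → weight (N S v) (λ u → g u v))
  double-counting S g = begin
    sum (λ v → weight (N S v) (g v))
      ≡⟨ sum-cong-≗ (λ v → weight-N S v (g v)) ⟩
    sum (λ v → sum (λ u → 𝟙 (joined? S v u) * g v u))
      ≡⟨ ∑-comm (λ v u → 𝟙 (joined? S v u) * g v u) ⟩
    sum (λ u → sum (λ v → 𝟙 (joined? S v u) * g v u))
      ≡⟨ sum-cong-≗ (λ u → sum-cong-≗ (λ v →
           cong (_* g v u) (𝟙-⇔ (joined? S v u) (joined? S u v) ~-sym ~-sym))) ⟩
    sum (λ u → sum (λ v → 𝟙 (joined? S u v) * g v u))
      ≡⟨ sum-cong-≗ (λ u → weight-N S u (λ v → g v u)) ⟨
    sum (λ u → weight (N S u) (λ v → g v u)) ∎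
    where open ≡-Reasoning

  -- Here `g v u` is the charge that `v` sends to `u`. The hypothesis says that `q * deg S v`, minus
  -- what `v` sends and plus what it receives, is at least `p` on `S`; in the sum over all `v` the
  -- flow cancels.
  discharging : ∀ S p q (g : Vertex → Vertex → ℕ) →
    (∀ v → p * 𝟙 (v ∈ˢ? S) + weight (N S v) (g v) ≤ q * deg S v + weight (N S v) (λ u → g u v)) →
    p * ∣ S ∣ ≤ q * sum (deg S)
  discharging S p q g local = ℕ.+-cancelʳ-≤ (sum (λ v → weight (N S v) (g v))) _ _ (begin
    p * ∣ S ∣ + flow
      ≡⟨ cong (_+ flow) (trans (cong (p *_) (∣∣≡sum S)) (sym (sum-*ˡ p (λ v → 𝟙 (v ∈ˢ? S))))) ⟩
    sum (λ v → p * 𝟙 (v ∈ˢ? S)) + flow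
      ≡⟨ ∑-distrib-+ (λ v → p * 𝟙 (v ∈ˢ? S)) (λ v → weight (N S v) (g v)) ⟨
    sum (λ v → p * 𝟙 (v ∈ˢ? S) + weight (N S v) (g v))
      ≤⟨ sum-mono local ⟩
    sum (λ v → q * deg S v + weight (N S v) (λ u → g u v))
      ≡⟨ ∑-distrib-+ (λ v → q * deg S v) (λ v → weight (N S v) (λ u → g u v)) ⟩
    sum (λ v → q * deg S v) + sum (λ v → weight (N S v) (λ u → g u v))
      ≡⟨ cong₂ _+_ (sum-*ˡ q (deg S)) (sym (double-counting S g)) ⟩
    q * sum (deg S) + flow ∎)
    where
    open ℕ.≤-Reasoning
    flow = sum (λ v → weight (N S v) (g v))

  inside? : ∀ (S : Subset n) (uv : Vertex × Vertex) → Dec (proj₁ uv ∈ˢ S × proj₂ uv ∈ˢ S)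
  inside? S (u , v) = (u ∈ˢ? S) ×-dec (v ∈ˢ? S)

  E[_] : Subset n → Subset ∣E∣
  E[ S ] = comprehension (inside? S ∘ ends)

  up? : ∀ u v → Dec (u Fin.< v × Adj u v)
  up? u v = (u Fin.<? v) ×-dec adj? u v

  ∣E[]∣ : ∀ S → ∣ E[ S ] ∣ ≡ sum (λ u → sum (λ v → 𝟙 (up? u v) * 𝟙 (inside? S (u , v))))
  ∣E[]∣ S = begin
    ∣ E[ S ] ∣
      ≡⟨ ∣comprehension∣ (inside? S ∘ ends) ⟩
    sum (λ e → 𝟙 (inside? S (ends e)))
      ≡⟨ weight-lookup edges (𝟙 ∘ inside? S) ⟩
    weight edges (𝟙 ∘ inside? S)
      ≡⟨ weight-filter (λ (u , v) → up? u v) (cartesianProduct (allFin n) (allFin n))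
           (𝟙 ∘ inside? S) ⟩
    weight (cartesianProduct (allFin n) (allFin n)) both
      ≡⟨ weight-× (allFin n) (allFin n) both ⟩
    weight (allFin n) (λ u → weight (allFin n) (λ v → both (u , v)))
      ≡⟨ weight-allFin n (λ u → weight (allFin n) (λ v → both (u , v))) ⟩
    sum (λ u → weight (allFin n) (λ v → both (u , v)))
      ≡⟨ sum-cong-≗ (λ u → weight-allFin n (λ v → both (u , v))) ⟩
    sum (λ u → sum (λ v → both (u , v))) ∎
    where
    open ≡-Reasoning
    both : Vertex × Vertex → ℕ
    both (u , v) = 𝟙 (up? u v) * 𝟙 (inside? S (u , v))

  -- Each adjacent ordered pair is increasing in exactly one of its two orders. This splits the
  -- degree sum into two double sums that are equal after exchanging the variables, and each counts
  -- the edges inside `S`.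
  handshake : ∀ S → sum (deg S) ≡ 2 * ∣ E[ S ] ∣
  handshake S = begin
    sum (deg S)
      ≡⟨ sum-cong-≗ (deg≡sum S) ⟩
    sum (λ u → sum (λ v → 𝟙 (joined? S u v)))
      ≡⟨ sum-cong-≗ (λ u → trans (sum-cong-≗ (split u)) (∑-distrib-+ (A u) (λ v → A v u))) ⟩
    sum (λ u → sum (A u) + sum (λ v → A v u))
      ≡⟨ ∑-distrib-+ (λ u → sum (A u)) (λ u → sum (λ v → A v u)) ⟩
    sum (λ u → sum (A u)) + sum (λ u → sum (λ v → A v u))
      ≡⟨ cong₂ _+_ refl (∑-comm (λ u v → A v u)) ⟩
    sum (λ u → sum (A u)) + sum (λ u → sum (A u))
      ≡⟨ cong₂ _+_ (∣E[]∣ S) (trans (ℕ.+-identityʳ _) (∣E[]∣ S)) ⟨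
    2 * ∣ E[ S ] ∣ ∎
    where
    open ≡-Reasoning
    A : Vertex → Vertex → ℕ
    A u v = 𝟙 (up? u v) * 𝟙 (inside? S (u , v))

    A-no : ∀ u v → ¬ (u Fin.< v × S ⊢ u ~ v) → A u v ≡ 0
    A-no u v ¬p = case up? u v of λ where
      (no ¬up)         → cong (_* 𝟙 (inside? S (u , v))) (𝟙-no (up? u v) ¬up)
      (yes (u<v , uv)) → trans
        (cong (𝟙 (up? u v) *_) (𝟙-no (inside? S (u , v)) λ (u∈ , v∈) → ¬p (u<v , u∈ , v∈ , uv)))
        (ℕ.*-zeroʳ (𝟙 (up? u v)))

    A-yes : ∀ u v → u Fin.< v → S ⊢ u ~ v → A u v ≡ 1
    A-yes u v u<v (u∈ , v∈ , uv) =
      cong₂ _*_ (𝟙-yes (up? u v) (u<v , uv)) (𝟙-yes (inside? S (u , v)) (u∈ , v∈))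

    split : ∀ u v → 𝟙 (joined? S u v) ≡ A u v + A v u
    split u v = case joined? S u v of λ where
      (no ¬uv) → trans (𝟙-no (joined? S u v) ¬uv)
        (sym (cong₂ _+_ (A-no u v (¬uv ∘ proj₂)) (A-no v u (¬uv ∘ ~-sym ∘ proj₂))))
      (yes uv) → trans (𝟙-yes (joined? S u v) uv) (case Fin.<-cmp u v of λ where
        (tri< u<v _ v≮u) → sym (cong₂ _+_ (A-yes u v u<v uv) (A-no v u (v≮u ∘ proj₁)))
        (tri≈ _ u≡v _)   → contradiction u≡v (~-≢ uv)
        (tri> u≮v _ v<u) → sym (cong₂ _+_ (A-no u v (u≮v ∘ proj₁)) (A-yes v u v<u (~-sym uv))))

  -- The set `S` with all edges inside it is one of the subgraphs bounded by `mad G`, and by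
  -- `handshake` its average degree is the degree sum divided by the size of `S`.
  sparse : ∀ p q {{_ : NonZero q}} → mad G < + p / q →
           ∀ S {{_ : NonZero ∣ S ∣}} → q * sum (deg S) ℕ.< p * ∣ S ∣
  sparse p q mad< S =
    subst (ℕ._< p * ∣ S ∣) (trans (ℕ.*-comm (2 * ∣ E[ S ] ∣) q) (cong (q *_) (sym (handshake S))))
      (/-cancel-< (2 * ∣ E[ S ] ∣) ∣ S ∣ p q (ℚ.≤-<-trans (mad-upper
        (subgraph S E[ S ] (λ e e∈ → ∈-comprehension⁻ (inside? S ∘ ends) e∈))) mad<))

  module _ {S S′ : Subset n} (S′⊆S : ∀ {v} → v ∈ˢ S′ → v ∈ˢ S) where

    ~-mono : ∀ {u v} → S′ ⊢ u ~ v → S ⊢ u ~ v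
    ~-mono (u∈ , v∈ , uv) = S′⊆S u∈ , S′⊆S v∈ , uv

    deg-mono : ∀ v → deg S′ v ≤ deg S v
    deg-mono v = filter-mono (joined? S′ v) (joined? S v) ~-mono (allFin n)

    deg-mono-< : ∀ {u v} → S ⊢ u ~ v → v ∉ˢ S′ → deg S′ u ℕ.< deg S u
    deg-mono-< {u} {v} uv v∉ = filter-mono-< (joined? S′ u) (joined? S u) ~-mono
      (∈-allFin v) uv (v∉ ∘ proj₁ ∘ proj₂)

-- Applied to a neighbor list, this enumerates the neighbors other than a known one, their number
-- being one less than the degree.
pick : ∀ {A : Set} {xs : List A} {x} → Unique xs → x ∈ xs →
       ∃[ ys ] length xs ≡ suc (length ys) × Unique ys ×
         (∀ {y} → y ∈ ys → y ∈ xs × y ≢ x) × (∀ {y} → y ∈ xs → y ≡ x ⊎ y ∈ ys)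
pick {xs = x ∷ xs} (x∉ ∷ uniq) (here refl) =
  xs , refl , uniq , (λ y∈ → there y∈ , λ { refl → All.All¬⇒¬Any x∉ y∈ }) ,
  λ { (here refl) → inj₁ refl ; (there y∈) → inj₂ y∈ }
pick {xs = z ∷ xs} (z∉ ∷ uniq) (there x∈) =
  let ys , len , uniq′ , ys⊆ , cover = pick uniq x∈ in
  z ∷ ys , cong suc len ,
  All.tabulate (λ y∈ z≡y → All.All¬⇒¬Any z∉ (subst (_∈ xs) (sym z≡y) (proj₁ (ys⊆ y∈)))) ∷ uniq′ ,
  (λ { (here refl) → here refl , λ { refl → All.All¬⇒¬Any z∉ x∈ }
     ; (there y∈)  → let y∈xs , y≢x = ys⊆ y∈ in there y∈xs , y≢x }) ,
  λ { (here refl) → inj₂ (here refl) ; (there y∈) → map₂ there (cover y∈) }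

module _ {n : ℕ} where

  infixl 5 _∖_

  _∖_ : Subset n → List (Fin n) → Subset n
  S ∖ T = comprehension (λ v → (v ∈ˢ? S) ×-dec ¬? (Any.any? (v Fin.≟_) T))

  module _ {S : Subset n} {T : List (Fin n)} where

    ∈-∖⁺ : ∀ {v} → v ∈ˢ S → v ∉ T → v ∈ˢ S ∖ T
    ∈-∖⁺ v∈ v∉ = ∈-comprehension⁺ (λ v → (v ∈ˢ? S) ×-dec ¬? (Any.any? (v Fin.≟_) T)) (v∈ , v∉)

    ∈-∖⁻ : ∀ {v} → v ∈ˢ S ∖ T → v ∈ˢ S × v ∉ T
    ∈-∖⁻ = ∈-comprehension⁻ (λ v → (v ∈ˢ? S) ×-dec ¬? (Any.any? (v Fin.≟_) T))

  ∖-⊂ : ∀ {S} T {v} → v ∈ˢ S → v ∈ T → S ∖ T ⊂ S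
  ∖-⊂ T v∈S v∈T = proj₁ ∘ ∈-∖⁻ {T = T} , _ , v∈S , λ v∈ → proj₂ (∈-∖⁻ {T = T} v∈) v∈T

  -- Well-founded induction on proper inclusion. The empty set is a separate case because average
  -- degrees are defined for nonempty vertex sets only.
  no-least-counterexample : ∀ (P : Subset n → Set) →
    (∀ S → (∀ v → v ∉ˢ S) → P S) →
    (∀ S → NonZero ∣ S ∣ → (∀ {S′} → S′ ⊂ S → ¬ ¬ P S′) → ¬ ¬ P S) →
    ∀ S → ¬ ¬ P S
  no-least-counterexample P base step = WF.All.wfRec ⊂-wellFounded _ (λ S → ¬ ¬ P S)
    λ S rec ¬P → case nonempty? S of λ where
      (no empty)      → ¬P (base S (λ v v∈ → empty (v , v∈)))
      (yes (v , v∈S)) → step S (ℕ.>-nonZero (ℕ.≤-<-trans z≤n (x∈p⇒∣p-x∣<∣p∣ v∈S))) rec ¬P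

-- Neighborhoods and colorings in subcubic graphs

module Subcubic-induced (G : Graph) (subcubic : Subcubic G) where

  open Graph G
  open Induced G

  deg≤3 : ∀ S v → deg S v ≤ 3
  deg≤3 S v = ℕ.≤-trans (filter-mono (joined? S v) (adj? v) (proj₂ ∘ proj₂) (allFin n))
    (ℕ.≤-trans (All.lookup (ℕ-Extrema.xs≤max 0 (map degree (allFin n))) (∈-map⁺ degree (∈-allFin v)))
      subcubic)

  module _ {S : Subset n} {v u : Vertex} (vu : S ⊢ v ~ u) where

    neighbors-of-2 : deg S v ≡ 2 →
      ∃[ w ] S ⊢ v ~ w × w ≢ u × (∀ {c} → S ⊢ v ~ c → c ≡ u ⊎ c ≡ w)
    neighbors-of-2 deg≡2 with pick (N-unique S v) (∈-N⁺ vu)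
    ... | [] , len , _ = case trans (sym deg≡2) len of λ ()
    ... | w ∷ [] , _ , _ , ys⊆ , cover =
      w , ∈-N⁻ (proj₁ (ys⊆ (here refl))) , proj₂ (ys⊆ (here refl)) ,
      λ vc → map₂ (λ { (here c≡w) → c≡w }) (cover (∈-N⁺ vc))
    ... | _ ∷ _ ∷ _ , len , _ = case trans (sym deg≡2) len of λ ()

    neighbors-of-3 : deg S v ≡ 3 →
      ∃[ a ] ∃[ b ] (S ⊢ v ~ a × a ≢ u) × (S ⊢ v ~ b × b ≢ u) × a ≢ b ×
        (∀ {c} → S ⊢ v ~ c → c ≡ u ⊎ c ≡ a ⊎ c ≡ b)
    neighbors-of-3 deg≡3 with pick (N-unique S v) (∈-N⁺ vu)
    ... | [] , len , _ = case trans (sym deg≡3) len of λ ()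
    ... | _ ∷ [] , len , _ = case trans (sym deg≡3) len of λ ()
    ... | a ∷ b ∷ [] , _ , ((a≢b ∷ []) ∷ _) , ys⊆ , cover =
      a , b , (∈-N⁻ (proj₁ (ys⊆ (here refl))) , proj₂ (ys⊆ (here refl))) ,
      (∈-N⁻ (proj₁ (ys⊆ (there (here refl)))) , proj₂ (ys⊆ (there (here refl)))) , a≢b ,
      λ vc → map₂ (λ { (here c≡a) → inj₁ c≡a ; (there (here c≡b)) → inj₂ c≡b }) (cover (∈-N⁺ vc))
    ... | _ ∷ _ ∷ _ ∷ _ , len , _ = case trans (sym deg≡3) len of λ ()

  two-neighbors : ∀ {S v a b} → deg S v ≡ 2 → S ⊢ v ~ a → S ⊢ v ~ b → b ≢ a →
    ∀ {c} → S ⊢ v ~ c → c ≡ a ⊎ c ≡ b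
  two-neighbors deg≡2 va vb b≢a vc with neighbors-of-2 va deg≡2
  ... | _ , _ , _ , cover with cover vb
  ...   | inj₁ b≡a  = contradiction b≡a b≢a
  ...   | inj₂ refl = cover vc

  third-neighbor : ∀ {S v a b} → deg S v ≡ 3 → S ⊢ v ~ a → S ⊢ v ~ b → b ≢ a →
    ∃[ c ] S ⊢ v ~ c × c ≢ a × c ≢ b × (∀ {d} → S ⊢ v ~ d → d ≡ a ⊎ d ≡ b ⊎ d ≡ c)
  third-neighbor deg≡3 va vb b≢a with neighbors-of-3 va deg≡3
  ... | x , y , (vx , x≢a) , (vy , y≢a) , x≢y , cover with cover vb
  ...   | inj₁ b≡a         = contradiction b≡a b≢a
  ...   | inj₂ (inj₁ refl) = y , vy , y≢a , x≢y ∘ sym , cover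
  ...   | inj₂ (inj₂ refl) = x , vx , x≢a , x≢y , map₂ swap ∘ cover

  three-neighbors : ∀ {S v a b c} → deg S v ≡ 3 → S ⊢ v ~ a → S ⊢ v ~ b → S ⊢ v ~ c →
    b ≢ a → c ≢ a → c ≢ b → ∀ {d} → S ⊢ v ~ d → d ≡ a ⊎ d ≡ b ⊎ d ≡ c
  three-neighbors deg≡3 va vb vc b≢a c≢a c≢b vd with third-neighbor deg≡3 va vb b≢a
  ... | _ , _ , _ , _ , cover with cover vc
  ...   | inj₁ c≡a         = contradiction c≡a c≢a
  ...   | inj₂ (inj₁ c≡b)  = contradiction c≡b c≢b
  ...   | inj₂ (inj₂ refl) = cover vd

  FewNeighbors : Subset n → Vertex → Set
  FewNeighbors S v =
    (∀ {c} → ¬ S ⊢ v ~ c) ⊎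
    (∃[ u ] S ⊢ v ~ u × deg S v ≡ 1 × (∀ {c} → S ⊢ v ~ c → c ≡ u)) ⊎
    (∃[ u ] S ⊢ v ~ u × deg S v ≡ 2)

  few-neighbors : ∀ S v → deg S v ≤ 2 → FewNeighbors S v
  few-neighbors S v deg≤2 = go (N S v) refl
    where
    go : ∀ xs → N S v ≡ xs → FewNeighbors S v
    go []           eq = inj₁ λ {c} vc → case subst (c ∈_) eq (∈-N⁺ vc) of λ ()
    go (u ∷ [])     eq = inj₂ (inj₁ (u , ∈-N⁻ (subst (u ∈_) (sym eq) (here refl)) , cong length eq ,
      λ {c} vc → case subst (c ∈_) eq (∈-N⁺ vc) of λ { (here c≡u) → c≡u }))
    go (u ∷ _ ∷ []) eq = inj₂ (inj₂ (u , ∈-N⁻ (subst (u ∈_) (sym eq) (here refl)) , cong length eq))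
    go (_ ∷ _ ∷ _ ∷ _) eq = case subst (_≤ 2) (cong length eq) deg≤2 of λ { (s≤s (s≤s ())) }

  N-outside : ∀ {S v} → v ∉ˢ S → N S v ≡ []
  N-outside {S} {v} v∉ with N S v in eq
  ... | []    = refl
  ... | u ∷ _ = contradiction (proj₁ (∈-N⁻ {S} {v} (subst (u ∈_) (sym eq) (here refl)))) v∉

  -- Since `d ≡ a` is allowed, this covers cycles of length three together with paths; the other
  -- distinctness conditions follow from adjacency.
  Proper : ∀ {k} → Subset n → (Vertex → Vertex → Fin k) → Set
  Proper S f = ∀ {a b c d} → S ⊢ a ~ b → S ⊢ b ~ c → S ⊢ c ~ d → a ≢ c → b ≢ d → f a b ≢ f c d

  HasProper : ℕ → Subset n → Set
  HasProper k S = ∃[ f ] (∀ u v → f u v ≡ f v u) × Proper {k} S f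

  proper⇒injectivelyColorable : ∀ {k} → HasProper k ⊤ → InjectivelyColorable G k
  proper⇒injectivelyColorable {k} (f , f-sym , proper) = color , valid
    where
    color : Edge → Fin k
    color e = f (proj₁ (ends e)) (proj₂ (ends e))

    ends-adj : ∀ e → Adj (proj₁ (ends e)) (proj₂ (ends e))
    ends-adj e = proj₂ (proj₂ (∈-filter⁻ (λ (u , v) → (u Fin.<? v) ×-dec adj? u v)
      {xs = cartesianProduct (allFin n) (allFin n)} (∈-lookup {xs = edges} e)))

    joins : ∀ {e u v} → Joins e u v → ⊤ ⊢ u ~ v × color e ≡ f u v
    joins {e} (inj₁ refl) = (∈⊤ , ∈⊤ , ends-adj e) , refl
    joins {e} (inj₂ refl) = (∈⊤ , ∈⊤ , adj-sym (ends-adj e)) , f-sym _ _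

    valid : ∀ e₁ e₂ e₃ → Consecutive G e₁ e₂ e₃ → color e₁ ≢ color e₃
    valid e₁ e₂ e₃ (a , b , c , d , ab , bc , cd , distinct) eq =
      let a~b , eq₁ = joins {e₁} ab
          b~c , _   = joins {e₂} bc
          c~d , eq₃ = joins {e₃} cd
          a≢c , b≢d = nonadjacent distinct
      in proper a~b b~c c~d a≢c b≢d (trans (sym eq₁) (trans eq eq₃))
      where
      nonadjacent : Unique (a ∷ b ∷ c ∷ d ∷ []) ⊎ (Unique (a ∷ b ∷ c ∷ []) × d ≡ a) → a ≢ c × b ≢ d
      nonadjacent (inj₁ ((_ ∷ a≢c ∷ _) ∷ (_ ∷ b≢d ∷ _) ∷ _))          = a≢c , b≢d
      nonadjacent (inj₂ (((a≢b ∷ a≢c ∷ _) ∷ _) , refl)) = a≢c , a≢b ∘ sym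

  -- The double negation of the induction is removed here, by deciding colorability with `k` colors.
  χ′inj≤ : ∀ {k} → ¬ ¬ HasProper k ⊤ → χ′inj G ≤ k
  χ′inj≤ {k} ¬¬proper = proj₂ (χ′inj-isMinimum G) k (decidable-stable (injectivelyColorable? G k)
    (¬¬proper ∘ (_∘ proper⇒injectivelyColorable)))

-- Greedy coloring with 6 and 7 colors

-- If every color occurred in `xs`, then their positions would inject `k` colors into fewer than `k`
-- places.
fresh : ∀ {k} (xs : List (Fin k)) → length xs ℕ.< k → ∃[ x ] x ∉ xs
fresh {k} xs short = case Fin.any? (λ x → ¬? (Any.any? (x Fin.≟_) xs)) of λ where
  (yes p) → p
  (no ¬p) →
    let x∈xs : ∀ x → x ∈ xs
        x∈xs x = decidable-stable (Any.any? (x Fin.≟_) xs) (λ x∉ → ¬p (x , x∉))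
        i , j , i<j , eq = Fin.pigeonhole short (Any.index ∘ x∈xs)
    in contradiction (trans (Any.lookup-index (x∈xs i)) (trans (cong (List.lookup xs) eq)
         (sym (Any.lookup-index (x∈xs j))))) (Fin.<⇒≢ i<j)

module Greedy (G : Graph) (subcubic : Subcubic G) where

  open Graph G
  open Induced G
  open Subcubic-induced G subcubic

  Same : Vertex × Vertex → Vertex → Vertex → Set
  Same (u , v) a b = (a ≡ u × b ≡ v) ⊎ (a ≡ v × b ≡ u)

  same? : ∀ e a b → Dec (Same e a b)
  same? (u , v) a b = ((a Fin.≟ u) ×-dec (b Fin.≟ v)) ⊎-dec ((a Fin.≟ v) ×-dec (b Fin.≟ u))

  Same-sym : ∀ e {a b} → Same e a b → Same e b a
  Same-sym _ (inj₁ (p , q)) = inj₂ (q , p)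
  Same-sym _ (inj₂ (p , q)) = inj₁ (q , p)

  -- The edges colored so far: those left after the deletion, and those of `es`, which have been
  -- colored back.
  Colored : Subset n → List (Vertex × Vertex) → Vertex → Vertex → Set
  Colored S es a b = S ⊢ a ~ b ⊎ Any (λ e → Same e a b) es

  Colored-sym : ∀ {S es a b} → Colored S es a b → Colored S es b a
  Colored-sym (inj₁ ab) = inj₁ (~-sym ab)
  Colored-sym (inj₂ ab) = inj₂ (Any.map (λ {e} → Same-sym e) ab)

  -- The middle edge `b c` ranges over all of `G` and may itself be uncolored: two colored edges
  -- already conflict across an edge that is colored later.
  record Partial (k : ℕ) (S : Subset n) (es : List (Vertex × Vertex)) : Set where
    field
      color     : Vertex → Vertex → Fin k
      color-sym : ∀ u v → color u v ≡ color v u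
      valid     : ∀ {a b c d} → Colored S es a b → Adj b c → Colored S es c d →
                  a ≢ c → b ≢ d → color a b ≢ color c d

  open Partial

  -- At most m colored edges follow u, v as the third edge of a path.
  Followers : Subset n → List (Vertex × Vertex) → Vertex → Vertex → ℕ → Set
  Followers S es u v m = ∃[ L ] length L ≤ m ×
    (∀ {c d} → Adj v c → c ≢ u → Colored S es c d → d ≢ v → (c , d) ∈ L)

  -- The edge `u v` conflicts only with colored third edges of paths leaving through `v` or through
  -- `u`, hence with at most `m₁ + m₂` colors.
  extend : ∀ {k S es u v m₁ m₂} → Followers S es u v m₁ → Followers S es v u m₂ →
           m₁ + m₂ ℕ.< k → Partial k S es → Partial k S ((u , v) ∷ es)
  extend {k} {S} {es} {u} {v} (L₁ , len₁ , follow₁) (L₂ , len₂ , follow₂) <k P = record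
    { color     = color′
    ; color-sym = color′-sym
    ; valid     = valid′
    }
    where
    forbidden : List (Fin k)
    forbidden = map (λ (c , d) → color P c d) (L₁ List.++ L₂)

    free : ∃[ x ] x ∉ forbidden
    free = fresh forbidden (ℕ.≤-<-trans (ℕ.≤-reflexive (trans (List.length-map _ (L₁ List.++ L₂))
      (List.length-++ L₁))) (ℕ.≤-<-trans (ℕ.+-mono-≤ len₁ len₂) <k))

    x : Fin k
    x = proj₁ free

    free₁ : ∀ {c d} → (c , d) ∈ L₁ → x ≢ color P c d
    free₁ cd∈ x≡ = proj₂ free (subst (_∈ forbidden) (sym x≡) (∈-map⁺ _ (∈-++⁺ˡ cd∈)))

    free₂ : ∀ {c d} → (c , d) ∈ L₂ → x ≢ color P c d
    free₂ cd∈ x≡ = proj₂ free (subst (_∈ forbidden) (sym x≡) (∈-map⁺ _ (∈-++⁺ʳ L₁ cd∈)))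

    color′ : Vertex → Vertex → Fin k
    color′ a b = if does (same? (u , v) a b) then x else color P a b

    color′-new : ∀ {a b} → Same (u , v) a b → color′ a b ≡ x
    color′-new {a} {b} s = cong (λ t → if t then x else color P a b) 
      (dec-true (same? (u , v) a b) s)

    color′-old : ∀ {a b} → ¬ Same (u , v) a b → color′ a b ≡ color P a b
    color′-old {a} {b} ¬s = cong (λ t → if t then x else color P a b) 
      (dec-false (same? (u , v) a b) ¬s)

    color′-sym : ∀ a b → color′ a b ≡ color′ b a
    color′-sym a b = case same? (u , v) a b of λ where
      (yes s) → trans (color′-new s) (sym (color′-new (Same-sym (u , v) s)))
      (no ¬s) → trans (color′-old ¬s) (trans (color-sym P a b)
        (sym (color′-old (¬s ∘ Same-sym (u , v)))))

    old : ∀ {a b} → ¬ Same (u , v) a b → Colored S ((u , v) ∷ es) a b → Colored S es a b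
    old ¬s (inj₁ ab)         = inj₁ ab
    old ¬s (inj₂ (here s))   = contradiction s ¬s
    old ¬s (inj₂ (there ab)) = inj₂ ab

    new-old : ∀ {a b c d} → Same (u , v) a b → Adj b c → Colored S es c d → a ≢ c → b ≢ d →
              x ≢ color P c d
    new-old (inj₁ (refl , refl)) bc cd a≢c b≢d = free₁ (follow₁ bc (a≢c ∘ sym) cd (b≢d ∘ sym))
    new-old (inj₂ (refl , refl)) bc cd a≢c b≢d = free₂ (follow₂ bc (a≢c ∘ sym) cd (b≢d ∘ sym))

    new-new : ∀ {a b c d} → Same (u , v) a b → Adj b c → Same (u , v) c d → a ≢ c → ⊥
    new-new (inj₁ (refl , refl)) bc (inj₁ (refl , refl)) a≢c = a≢c refl
    new-new (inj₁ (refl , refl)) bc (inj₂ (refl , refl)) a≢c = adj-irrefl refl bc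
    new-new (inj₂ (refl , refl)) bc (inj₁ (refl , refl)) a≢c = adj-irrefl refl bc
    new-new (inj₂ (refl , refl)) bc (inj₂ (refl , refl)) a≢c = a≢c refl

    valid′ : ∀ {a b c d} → Colored S ((u , v) ∷ es) a b → Adj b c → Colored S ((u , v) ∷ es) c d →
             a ≢ c → b ≢ d → color′ a b ≢ color′ c d
    valid′ {a} {b} {c} {d} ab bc cd a≢c b≢d eq = decide (same? (u , v) a b) (same? (u , v) c d)
      where
      decide : Dec (Same (u , v) a b) → Dec (Same (u , v) c d) → ⊥
      decide (yes s) (yes t) = new-new s bc t a≢c
      decide (yes s) (no ¬t) = new-old s bc (old ¬t cd) a≢c b≢d
        (trans (sym (color′-new s)) (trans eq (color′-old ¬t)))
      -- The path is read backwards, as `d`, `c`, `b`, `a`, so that the new edge comes first.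
      decide (no ¬s) (yes t) = new-old (Same-sym (u , v) t) (adj-sym bc) (Colored-sym (old ¬s ab))
        (b≢d ∘ sym) (a≢c ∘ sym)
        (trans (sym (color′-new t)) (trans (sym eq) (trans (color′-old ¬s) (color-sym P a b))))
      decide (no ¬s) (no ¬t) = valid P (old ¬s ab) bc (old ¬t cd) a≢c b≢d
        (trans (sym (color′-old ¬s)) (trans eq (color′-old ¬t)))

  start : ∀ {k S} → HasProper k S → Partial k S []
  start (f , f-sym , proper) = record
    { color     = f
    ; color-sym = f-sym
    -- The ends of the middle edge are ends of colored edges, so it lies in `S` as well.
    ; valid     = λ { (inj₁ ab) bc (inj₁ cd) → proper ab (proj₁ (proj₂ ab) , proj₁ cd , bc) cd }
    }

  module Deletion (S : Subset n) (T : List Vertex) where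

    finish : ∀ {k es} → (∀ {t c} → t ∈ T → S ⊢ t ~ c → Any (λ e → Same e t c) es) →
             Partial k (S ∖ T) es → HasProper k S
    finish {es = es} covers P = color P , color-sym P ,
      λ ab (_ , _ , bc) cd → valid P (colored ab) bc (colored cd)
      where
      colored : ∀ {a b} → S ⊢ a ~ b → Colored (S ∖ T) es a b
      colored {a} {b} ab@(a∈ , b∈ , adj) =
        case Any.any? (a Fin.≟_) T , Any.any? (b Fin.≟_) T of λ where
          (yes a∈T , _)      → inj₂ (covers a∈T ab)
          (no a∉T , yes b∈T) → inj₂ (Any.map (λ {e} → Same-sym e) (covers b∈T (~-sym ab)))
          (no a∉T , no b∉T)  → inj₁ (∈-∖⁺ a∈ a∉T , ∈-∖⁺ b∈ b∉T , adj)

    module _ {es : List (Vertex × Vertex)} (es-in : All (λ (u , v) → S ⊢ u ~ v) es) where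

      colored⇒~ : ∀ {a b} → Colored (S ∖ T) es a b → S ⊢ a ~ b
      colored⇒~ (inj₁ (a∈ , b∈ , ab)) = proj₁ (∈-∖⁻ {T = T} a∈) , proj₁ (∈-∖⁻ {T = T} b∈) , ab
      colored⇒~ (inj₂ ab) with find ab
      ... | _ , e∈ , inj₁ (refl , refl) = All.lookup es-in e∈
      ... | _ , e∈ , inj₂ (refl , refl) = ~-sym (All.lookup es-in e∈)

      Leaving : Vertex → Vertex → ℕ → Set
      Leaving v c m = ∃[ L ] length L ≤ m × (∀ {d} → Colored (S ∖ T) es c d → d ≢ v → (c , d) ∈ L)

      leaving : ∀ {v c} m → S ⊢ v ~ c → deg S c ≤ suc m → Leaving v c m
      leaving {v} {c} m vc deg≤ =
        let ys , len , _ , _ , cover = pick (N-unique S c) (∈-N⁺ (~-sym vc)) in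
        map (c ,_) ys ,
        ℕ.≤-trans (ℕ.≤-reflexive (List.length-map (c ,_) ys))
          (ℕ.s≤s⁻¹ (subst (_≤ suc m) len deg≤)) ,
        λ cd d≢v → ∈-map⁺ (c ,_) ([ (λ d≡v → contradiction d≡v d≢v) , id ]′
          (cover (∈-N⁺ (colored⇒~ cd))))

      -- Each neighbor in `ys` has degree at most 3 and so at most two edges that do not lead back
      -- to `v`.
      followers-among : ∀ {u v} → v ∈ˢ S → ∀ ys → (∀ {y} → y ∈ ys → S ⊢ v ~ y) →
        (∀ {c} → S ⊢ v ~ c → c ≢ u → c ∈ ys) → Followers (S ∖ T) es u v (length ys * 2)
      followers-among {u} {v} v∈ ys ys~ cover =
        let L , len , ∈L = go ys ys~ in
        L , len , λ vc c≢u cd d≢v → ∈L (cover (v∈ , proj₁ (colored⇒~ cd) , vc) c≢u) cd d≢v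
        where
        go : ∀ zs → (∀ {y} → y ∈ zs → S ⊢ v ~ y) → ∃[ L ] length L ≤ length zs * 2 ×
             (∀ {c d} → c ∈ zs → Colored (S ∖ T) es c d → d ≢ v → (c , d) ∈ L)
        go []       _   = [] , z≤n , λ ()
        go (z ∷ zs) zs~ =
          let L₁ , len₁ , ∈L₁ = leaving 2 (zs~ (here refl)) (deg≤3 S z)
              L₂ , len₂ , ∈L₂ = go zs (zs~ ∘ there)
          in L₁ List.++ L₂ ,
             ℕ.≤-trans (ℕ.≤-reflexive (List.length-++ L₁)) (ℕ.+-mono-≤ len₁ len₂) ,
             λ { (here refl) cd d≢v → ∈-++⁺ˡ (∈L₁ cd d≢v)
               ; (there c∈)  cd d≢v → ∈-++⁺ʳ L₁ (∈L₂ c∈ cd d≢v) }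

      followers : ∀ {u v} m → S ⊢ u ~ v → deg S v ≤ suc m → Followers (S ∖ T) es u v (m * 2)
      followers {u} {v} m uv deg≤ =
        let ys , len , _ , ys⊆ , cover = pick (N-unique S v) (∈-N⁺ (~-sym uv))
            L , len′ , ∈L = followers-among {u} (proj₁ (proj₂ uv)) ys (∈-N⁻ ∘ proj₁ ∘ ys⊆)
              (λ vc c≢u → [ (λ c≡u → contradiction c≡u c≢u) , id ]′ (cover (∈-N⁺ vc)))
        in L , ℕ.≤-trans len′ (ℕ.*-monoˡ-≤ 2 (ℕ.s≤s⁻¹ (subst (_≤ suc m) len deg≤))) , ∈L

      followers-via₁ : ∀ {u v c₁ m} → v ∈ˢ S → Leaving v c₁ m →
        (∀ {c} → S ⊢ v ~ c → c ≢ u → c ≡ c₁) → Followers (S ∖ T) es u v m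
      followers-via₁ v∈ (L , len , ∈L) cover = L , len , λ vc c≢u cd d≢v →
        case cover (v∈ , proj₁ (colored⇒~ cd) , vc) c≢u of λ { refl → ∈L cd d≢v }

      followers-via₂ : ∀ {u v c₁ c₂ m₁ m₂} → v ∈ˢ S → Leaving v c₁ m₁ → Leaving v c₂ m₂ →
        (∀ {c} → S ⊢ v ~ c → c ≢ u → c ≡ c₁ ⊎ c ≡ c₂) → Followers (S ∖ T) es u v (m₁ + m₂)
      followers-via₂ v∈ (L₁ , len₁ , ∈L₁) (L₂ , len₂ , ∈L₂) cover =
        L₁ List.++ L₂ ,
        ℕ.≤-trans (ℕ.≤-reflexive (List.length-++ L₁)) (ℕ.+-mono-≤ len₁ len₂) ,
        λ vc c≢u cd d≢v → case cover (v∈ , proj₁ (colored⇒~ cd) , vc) c≢u of λ where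
          (inj₁ refl) → ∈-++⁺ˡ (∈L₁ cd d≢v)
          (inj₂ refl) → ∈-++⁺ʳ L₁ (∈L₂ cd d≢v)

-- Reducible configurations for 6 and 7 colors

module Greedy-reductions (G : Graph) (subcubic : Subcubic G) where

  open Graph G
  open Induced G
  open Subcubic-induced G subcubic
  open Greedy G subcubic

  module _ {k : ℕ} {S : Subset n} {v : Vertex} (v∈S : v ∈ˢ S) where

    open Deletion S (v ∷ [])

    remove-isolated : (∀ {c} → ¬ S ⊢ v ~ c) → HasProper k (S ∖ (v ∷ [])) → HasProper k S
    remove-isolated none = finish (λ { (here refl) vc → contradiction vc none }) ∘ start

    -- All conflicts lie beyond `u`: at most two further neighbors with two further edges each.
    remove-leaf : ∀ {u} → 4 ℕ.< k → S ⊢ v ~ u → deg S v ≡ 1 → (∀ {c} → S ⊢ v ~ c → c ≡ u) →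
                  HasProper k (S ∖ (v ∷ [])) → HasProper k S
    remove-leaf {u} 4<k vu deg≡1 cover =
      finish (λ { (here refl) vc → here (inj₁ (refl , cover vc)) }) ∘
      extend (followers [] 2 vu (deg≤3 S u)) (followers [] 0 (~-sym vu) (ℕ.≤-reflexive deg≡1)) 4<k ∘
      start

    -- The edge `v u` comes first: it meets `m * 2` edges beyond `u` and two at `w`. Then `v w`
    -- meets four edges beyond `w` and `m` at `u`. The bounds suit 7 colors with `m` equal to 2, and
    -- 6 colors with `m` equal to 1.
    remove-2-vertex : ∀ {u} m → m * 2 + 2 ℕ.< k → 4 + m ℕ.< k →
                      S ⊢ v ~ u → deg S u ≤ suc m → deg S v ≡ 2 →
                      HasProper k (S ∖ (v ∷ [])) → HasProper k S
    remove-2-vertex {u} m lt₁ lt₂ vu degu≤ deg≡2 with neighbors-of-2 vu deg≡2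
    ... | w , vw , w≢u , cover =
      finish (λ { (here refl) vc → case cover vc of λ where
        (inj₁ c≡u) → there (here (inj₁ (refl , c≡u)))
        (inj₂ c≡w) → here (inj₁ (refl , c≡w)) }) ∘
      extend (followers (vu ∷ []) 2 vw (deg≤3 S w))
             (followers-via₁ (vu ∷ []) v∈S (leaving (vu ∷ []) m vu degu≤)
               (λ vc c≢w → [ id , (λ c≡w → contradiction c≡w c≢w) ]′ (cover vc))) lt₂ ∘
      extend (followers [] m vu degu≤) (followers [] 1 (~-sym vu) (ℕ.≤-reflexive deg≡2)) lt₁ ∘
      start

  -- The uncolored edge x v₂ is what leaves a color for v₁ w₁, and similarly for v₂ w₂.
  remove-two-2-vertices : ∀ {S x v₁ v₂} → S ⊢ x ~ v₁ → S ⊢ x ~ v₂ → v₂ ≢ v₁ →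
    deg S x ≡ 3 → deg S v₁ ≡ 2 → deg S v₂ ≡ 2 → HasProper 6 (S ∖ (v₁ ∷ v₂ ∷ [])) → HasProper 6 S
  remove-two-2-vertices {S} {x} {v₁} {v₂} xv₁ xv₂ v₂≢v₁ degx deg₁ deg₂
    with third-neighbor degx xv₁ xv₂ v₂≢v₁
       | neighbors-of-2 (~-sym xv₁) deg₁ | neighbors-of-2 (~-sym xv₂) deg₂
  ... | y , xy , _ , _ , coverx | w₁ , vw₁ , w₁≢x , cover₁ | w₂ , vw₂ , w₂≢x , cover₂ =
    -- Read from the bottom up, the edges are colored in the order `v₁ w₁`, `v₂ w₂`, `v₁ x`, `v₂ x`.
    -- The first two meet at most 4 + 1 colored edges, the last two at most 3 + 2.
    finish covers ∘
    extend (followers-via₂ es₃-in x∈ (leaving es₃-in 1 xv₁ (ℕ.≤-reflexive deg₁))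
             (leaving es₃-in 2 xy (deg≤3 S y))
             (λ xc c≢ → case coverx xc of λ where
               (inj₁ c≡)        → inj₁ c≡
               (inj₂ (inj₁ c≡)) → contradiction c≡ c≢
               (inj₂ (inj₂ c≡)) → inj₂ c≡))
           (followers-via₁ es₃-in v₂∈ (leaving es₃-in 2 vw₂ (deg≤3 S w₂))
             (λ vc c≢ → [ (λ c≡ → contradiction c≡ c≢) , id ]′ (cover₂ vc))) ℕ.≤-refl ∘
    extend (followers-via₂ es₂-in x∈ (leaving es₂-in 1 xv₂ (ℕ.≤-reflexive deg₂))
             (leaving es₂-in 2 xy (deg≤3 S y))
             (λ xc c≢ → [ (λ c≡ → contradiction c≡ c≢) , id ]′ (coverx xc)))
           (followers-via₁ es₂-in v₁∈ (leaving es₂-in 2 vw₁ (deg≤3 S w₁))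
             (λ vc c≢ → [ (λ c≡ → contradiction c≡ c≢) , id ]′ (cover₁ vc))) ℕ.≤-refl ∘
    extend (followers es₁-in 2 vw₂ (deg≤3 S w₂))
           (followers-via₁ es₁-in v₂∈ ((x , y) ∷ [] , ℕ.≤-refl , λ xd d≢ →
             case coverx (colored⇒~ es₁-in xd) of λ where
               (inj₁ refl)        → contradiction xd xv₁-uncolored
               (inj₂ (inj₁ d≡))   → contradiction d≡ d≢
               (inj₂ (inj₂ refl)) → here refl)
             (λ vc c≢ → [ id , (λ c≡ → contradiction c≡ c≢) ]′ (cover₂ vc))) ℕ.≤-refl ∘
    extend (followers [] 2 vw₁ (deg≤3 S w₁))
           (followers-via₁ [] v₁∈ ((x , y) ∷ [] , ℕ.≤-refl , λ xd d≢ →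
             case coverx (colored⇒~ [] xd) of λ where
               (inj₁ d≡)          → contradiction d≡ d≢
               (inj₂ (inj₁ refl)) → contradiction xd xv₂-uncolored
               (inj₂ (inj₂ refl)) → here refl)
             (λ vc c≢ → [ id , (λ c≡ → contradiction c≡ c≢) ]′ (cover₁ vc))) ℕ.≤-refl ∘
    start
    where
    open Deletion S (v₁ ∷ v₂ ∷ [])
    x∈ = proj₁ xv₁
    v₁∈ = proj₁ (proj₂ xv₁)
    v₂∈ = proj₁ (proj₂ xv₂)
    es₁-in = vw₁ ∷ []
    es₂-in = vw₂ ∷ es₁-in
    es₃-in = ~-sym xv₁ ∷ es₂-in

    xv₁-uncolored : ¬ Colored (S ∖ (v₁ ∷ v₂ ∷ [])) ((v₁ , w₁) ∷ []) x v₁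
    xv₁-uncolored (inj₁ (_ , v₁∈′ , _))           = proj₂ (∈-∖⁻ {T = v₁ ∷ v₂ ∷ []} v₁∈′) (here refl)
    xv₁-uncolored (inj₂ (here (inj₁ (x≡v₁ , _)))) = ~-≢ xv₁ x≡v₁
    xv₁-uncolored (inj₂ (here (inj₂ (x≡w₁ , _)))) = w₁≢x (sym x≡w₁)

    xv₂-uncolored : ¬ Colored (S ∖ (v₁ ∷ v₂ ∷ [])) [] x v₂
    xv₂-uncolored (inj₁ (_ , v₂∈′ , _)) = proj₂ (∈-∖⁻ {T = v₁ ∷ v₂ ∷ []} v₂∈′) (there (here refl))

    covers : ∀ {t c} → t ∈ v₁ ∷ v₂ ∷ [] → S ⊢ t ~ c →
             Any (λ e → Same e t c) ((v₂ , x) ∷ (v₁ , x) ∷ (v₂ , w₂) ∷ (v₁ , w₁) ∷ [])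
    covers (here refl) tc = case cover₁ tc of λ where
      (inj₁ c≡x) → there (here (inj₁ (refl , c≡x)))
      (inj₂ c≡w) → there (there (there (here (inj₁ (refl , c≡w)))))
    covers (there (here refl)) tc = case cover₂ tc of λ where
      (inj₁ c≡x) → here (inj₁ (refl , c≡x))
      (inj₂ c≡w) → there (there (here (inj₁ (refl , c≡w))))

-- Discharging for 6 and 7 colors

two three : ℕ → ℕ
two   d = 𝟙 (d ℕ.≟ 2)
three d = 𝟙 (d ℕ.≟ 3)

-- These lemmas substitute the neighbor list, the degree and the charges into the local inequality
-- of `discharging`, which leaves an inequality between known values.
module _ {A : Set} (p q : ℕ) {xs : List A} {i i′ d d′ : ℕ} {f g : A → ℕ} where

  balance₀ : xs ≡ [] → i ≡ i′ → d ≡ d′ → p * i′ + 0 ≤ q * d′ + 0 →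
             p * i + weight xs f ≤ q * d + weight xs g
  balance₀ refl refl refl h = h

  balance₂ : ∀ {a b fa fb ga gb} → xs ≡ a ∷ b ∷ [] → i ≡ i′ → d ≡ d′ →
             f a ≡ fa → f b ≡ fb → g a ≡ ga → g b ≡ gb →
             p * i′ + (fa + (fb + 0)) ≤ q * d′ + (ga + (gb + 0)) →
             p * i + weight xs f ≤ q * d + weight xs g
  balance₂ refl refl refl refl refl refl refl h = h

  balance₃ : ∀ {a b c fa fb fc ga gb gc} → xs ≡ a ∷ b ∷ c ∷ [] → i ≡ i′ → d ≡ d′ →
             f a ≡ fa → f b ≡ fb → f c ≡ fc → g a ≡ ga → g b ≡ gb → g c ≡ gc →
             p * i′ + (fa + (fb + (fc + 0))) ≤ q * d′ + (ga + (gb + (gc + 0))) →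
             p * i + weight xs f ≤ q * d + weight xs g
  balance₃ refl refl refl refl refl refl refl refl refl h = h

module Sparse (G : Graph) (subcubic : Subcubic G) where

  open Graph G
  open Induced G
  open Subcubic-induced G subcubic
  open Greedy-reductions G subcubic

  -- The last hypothesis makes a minimal counterexample too dense for `sparse`. The property `P` may
  -- be stronger than colorability, as is needed for the induction with 4 colors.
  colorable : ∀ p q {k} {{_ : NonZero q}} → mad G < + p / q → (P : Subset n → Set) →
    (∀ {S} → P S → HasProper k S) →
    (∀ S → (∀ v → v ∉ˢ S) → P S) →
    (∀ S → (∀ {S′} → S′ ⊂ S → ¬ ¬ P S′) → ¬ P S → p * ∣ S ∣ ≤ q * sum (deg S)) →
    χ′inj G ≤ k
  colorable p q mad< P proper base dense = χ′inj≤ λ ¬proper →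
    no-least-counterexample P base
      (λ S nonempty smaller ¬P →
        ℕ.<⇒≱ (sparse p q mad< S {{nonempty}}) (dense S smaller ¬P))
      ⊤ (¬proper ∘ proper)

  empty-proper : ∀ {k} S → (∀ v → v ∉ˢ S) → HasProper (suc k) S
  empty-proper S empty = (λ _ _ → zero) , (λ _ _ → refl) , λ ab → contradiction (proj₁ ab) (empty _)

  7-colorable : mad G < + 3 / 1 → χ′inj G ≤ 7
  7-colorable mad<3 = colorable 3 1 mad<3 (HasProper 7) id empty-proper dense
    where
    module _ (S : Subset n) (smaller : ∀ {S′} → S′ ⊂ S → ¬ ¬ HasProper 7 S′)
             (¬P : ¬ HasProper 7 S) where

      no-≤2-vertex : ∀ {v} → v ∈ˢ S → ¬ deg S v ≤ 2
      no-≤2-vertex {v} v∈S deg≤2 = smaller (∖-⊂ (v ∷ []) v∈S (here refl)) λ P → ¬P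
        (case few-neighbors S v deg≤2 of λ where
          (inj₁ none) → remove-isolated v∈S none P
          (inj₂ (inj₁ (u , vu , deg≡1 , cover))) →
            remove-leaf v∈S (ℕ.m≤n⇒m≤1+n (ℕ.n≤1+n 5)) vu deg≡1 cover P
          (inj₂ (inj₂ (u , vu , deg≡2))) →
            remove-2-vertex v∈S 2 ℕ.≤-refl ℕ.≤-refl vu (deg≤3 S u) deg≡2 P)

      -- No charge moves: all degrees in a minimal counterexample are at least 3, which is the
      -- required average.
      local : ∀ v → 3 * 𝟙 (v ∈ˢ? S) + weight (N S v) (λ _ → 0) ≤
                    1 * deg S v + weight (N S v) (λ _ → 0)
      local v = ℕ.+-monoˡ-≤ (weight (N S v) (λ _ → 0)) (case v ∈ˢ? S of λ where
        (yes v∈) → subst₂ _≤_ (cong (3 *_) (sym (𝟙-yes (v ∈ˢ? S) v∈))) (sym (ℕ.*-identityˡ _))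
                     (ℕ.≰⇒> (no-≤2-vertex v∈))
        (no v∉)  → subst (λ x → 3 * x ≤ 1 * deg S v) (sym (𝟙-no (v ∈ˢ? S) v∉)) z≤n)

      dense : 3 * ∣ S ∣ ≤ 1 * sum (deg S)
      dense = discharging S 3 1 (λ _ _ → 0) local

  -- Vertices outside `S` form a case of their own because `discharging` asks for its inequality at
  -- every vertex of `G`.
  data Degree-2-or-3 (S : Subset n) (v : Vertex) : Set where
    outside-S : v ∉ˢ S → deg S v ≡ 0 → N S v ≡ [] → Degree-2-or-3 S v
    is-2 : ∀ a b → v ∈ˢ S → deg S v ≡ 2 → N S v ≡ a ∷ b ∷ [] → a ≢ b →
           S ⊢ v ~ a → S ⊢ v ~ b → Degree-2-or-3 S v
    is-3 : ∀ a b c → v ∈ˢ S → deg S v ≡ 3 → N S v ≡ a ∷ b ∷ c ∷ [] → a ≢ b → a ≢ c → b ≢ c →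
           S ⊢ v ~ a → S ⊢ v ~ b → S ⊢ v ~ c → Degree-2-or-3 S v

  degree-2-or-3 : ∀ S → (∀ {v} → v ∈ˢ S → ¬ deg S v ≤ 1) → ∀ v → Degree-2-or-3 S v
  degree-2-or-3 S ≰1 v = case v ∈ˢ? S of λ where
      (no v∉)  → outside-S v∉ (cong length (N-outside v∉)) (N-outside v∉)
      (yes v∈) → go v∈ (N S v) refl (N-unique S v)
    where
    go : v ∈ˢ S → ∀ xs → N S v ≡ xs → Unique (N S v) → Degree-2-or-3 S v
    go v∈ []       eq _ = contradiction (subst (_≤ 1) (cong length (sym eq)) z≤n) (≰1 v∈)
    go v∈ (_ ∷ []) eq _ = contradiction (subst (_≤ 1) (cong length (sym eq)) ℕ.≤-refl) (≰1 v∈)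
    go v∈ (a ∷ b ∷ []) eq uniq with subst Unique eq uniq
    ... | (a≢b ∷ []) ∷ _ = is-2 a b v∈ (cong length eq) eq a≢b
      (∈-N⁻ (subst (a ∈_) (sym eq) (here refl))) (∈-N⁻ (subst (b ∈_) (sym eq) (there (here refl))))
    go v∈ (a ∷ b ∷ c ∷ []) eq uniq with subst Unique eq uniq
    ... | (a≢b ∷ a≢c ∷ []) ∷ (b≢c ∷ []) ∷ _ = is-3 a b c v∈ (cong length eq) eq a≢b a≢c b≢c
      (∈-N⁻ (subst (a ∈_) (sym eq) (here refl))) (∈-N⁻ (subst (b ∈_) (sym eq) (there (here refl))))
      (∈-N⁻ (subst (c ∈_) (sym eq) (there (there (here refl)))))
    go v∈ (_ ∷ _ ∷ _ ∷ _ ∷ _) eq _ =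
      case subst (_≤ 3) (cong length eq) (deg≤3 S v) of λ { (s≤s (s≤s (s≤s ()))) }

  neighbor-2-or-3 : ∀ {S v a} → (∀ {v} → v ∈ˢ S → ¬ deg S v ≤ 1) → S ⊢ v ~ a →
                    deg S a ≡ 2 ⊎ deg S a ≡ 3
  neighbor-2-or-3 {S} {v} {a} ≰1 (_ , a∈ , _) with degree-2-or-3 S ≰1 a
  ... | outside-S a∉ _ _ = contradiction a∈ a∉
  ... | is-2 _ _ _ deg≡2 _ _ _ _ = inj₁ deg≡2
  ... | is-3 _ _ _ _ deg≡3 _ _ _ _ _ _ _ = inj₂ deg≡3

  6-colorable : mad G < + 8 / 3 → χ′inj G ≤ 6
  6-colorable mad<8/3 = colorable 8 3 mad<8/3 (HasProper 6) id empty-proper dense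
    where
    module _ (S : Subset n) (smaller : ∀ {S′} → S′ ⊂ S → ¬ ¬ HasProper 6 S′)
             (¬P : ¬ HasProper 6 S) where

      no-≤1-vertex : ∀ {v} → v ∈ˢ S → ¬ deg S v ≤ 1
      no-≤1-vertex {v} v∈S deg≤1 = smaller (∖-⊂ (v ∷ []) v∈S (here refl)) λ P → ¬P
        (case few-neighbors S v (ℕ.m≤n⇒m≤1+n deg≤1) of λ where
          (inj₁ none) → remove-isolated v∈S none P
          (inj₂ (inj₁ (u , vu , deg≡1 , cover))) → remove-leaf v∈S (ℕ.n≤1+n 5) vu deg≡1 cover P
          (inj₂ (inj₂ (u , vu , deg≡2))) → case subst (_≤ 1) deg≡2 deg≤1 of λ { (s≤s ()) })

      no-adjacent-2s : ∀ {u v} → S ⊢ u ~ v → deg S u ≡ 2 → deg S v ≢ 2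
      no-adjacent-2s {u} uv degu degv = smaller (∖-⊂ (u ∷ []) (proj₁ uv) (here refl)) λ P →
        ¬P (remove-2-vertex (proj₁ uv) 1 (ℕ.n≤1+n 5) ℕ.≤-refl uv (ℕ.≤-reflexive degv) degu P)

      no-two-2-neighbors : ∀ {x u v} → deg S x ≡ 3 → S ⊢ x ~ u → S ⊢ x ~ v → u ≢ v →
                           deg S u ≡ 2 → deg S v ≢ 2
      no-two-2-neighbors {u = u} {v} degx xu xv u≢v degu degv =
        smaller (∖-⊂ (u ∷ v ∷ []) (proj₁ (proj₂ xu)) (here refl)) λ P →
        ¬P (remove-two-2-vertices xu xv (u≢v ∘ sym) degx degu degv P)

      -- In units of 1/3, a 2-vertex starts with 3 * 2 - 8 = -2 and receives 1 from each of its two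
      -- 3-neighbors. A 3-vertex starts with 1, which pays for its only possible 2-neighbor.
      charge : Vertex → Vertex → ℕ
      charge v a = three (deg S v) * two (deg S a)

      charge≡ : ∀ {v a i j} → deg S v ≡ i → deg S a ≡ j → charge v a ≡ three i * two j
      charge≡ refl refl = refl

      local : ∀ v → 8 * 𝟙 (v ∈ˢ? S) + weight (N S v) (charge v) ≤
                    3 * deg S v + weight (N S v) (λ u → charge u v)
      local v with degree-2-or-3 S no-≤1-vertex v
      ... | outside-S v∉ deg≡0 N≡ = balance₀ 8 3 N≡ (𝟙-no (v ∈ˢ? S) v∉) deg≡0 z≤n
      ... | is-2 a b v∈ deg≡2 N≡ _ va vb =
        case neighbor-2-or-3 no-≤1-vertex va , neighbor-2-or-3 no-≤1-vertex vb of λ where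
          (inj₁ a2 , _)       → contradiction a2 (no-adjacent-2s va deg≡2)
          (_       , inj₁ b2) → contradiction b2 (no-adjacent-2s vb deg≡2)
          (inj₂ a3 , inj₂ b3) → balance₂ 8 3 N≡ (𝟙-yes (v ∈ˢ? S) v∈) deg≡2
            (charge≡ deg≡2 a3) (charge≡ deg≡2 b3) (charge≡ a3 deg≡2) (charge≡ b3 deg≡2)
            (ℕ.≤ᵇ⇒≤ _ _ _)
      ... | is-3 a b c v∈ deg≡3 N≡ a≢b a≢c b≢c va vb vc =
        case neighbor-2-or-3 no-≤1-vertex va , neighbor-2-or-3 no-≤1-vertex vb ,
             neighbor-2-or-3 no-≤1-vertex vc of λ where
          (inj₁ a2 , inj₁ b2 , _)       → contradiction b2 (no-two-2-neighbors deg≡3 va vb a≢b a2)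
          (inj₁ a2 , _       , inj₁ c2) → contradiction c2 (no-two-2-neighbors deg≡3 va vc a≢c a2)
          (_       , inj₁ b2 , inj₁ c2) → contradiction c2 (no-two-2-neighbors deg≡3 vb vc b≢c b2)
          (inj₁ a2 , inj₂ b3 , inj₂ c3) → settle a2 b3 c3 (ℕ.≤ᵇ⇒≤ _ _ _)
          (inj₂ a3 , inj₁ b2 , inj₂ c3) → settle a3 b2 c3 (ℕ.≤ᵇ⇒≤ _ _ _)
          (inj₂ a3 , inj₂ b3 , inj₁ c2) → settle a3 b3 c2 (ℕ.≤ᵇ⇒≤ _ _ _)
          (inj₂ a3 , inj₂ b3 , inj₂ c3) → settle a3 b3 c3 (ℕ.≤ᵇ⇒≤ _ _ _)
        where
        settle : ∀ {i j k} → deg S a ≡ i → deg S b ≡ j → deg S c ≡ k →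
          8 * 1 + (three 3 * two i + (three 3 * two j + (three 3 * two k + 0))) ≤
          3 * 3 + (three i * two 3 + (three j * two 3 + (three k * two 3 + 0))) →
          8 * 𝟙 (v ∈ˢ? S) + weight (N S v) (charge v) ≤
          3 * deg S v + weight (N S v) (λ u → charge u v)
        settle da db dc = balance₃ 8 3 N≡ (𝟙-yes (v ∈ˢ? S) v∈) deg≡3
          (charge≡ deg≡3 da) (charge≡ deg≡3 db) (charge≡ deg≡3 dc)
          (charge≡ da deg≡3) (charge≡ db deg≡3) (charge≡ dc deg≡3)

      dense : 8 * ∣ S ∣ ≤ 3 * sum (deg S)
      dense = discharging S 8 3 charge local

-- Recoloring small configurations with 4 colors

Color : Set
Color = Fin 4

-- A Boolean test, so that the conditions in the finite checks below carry no proofs.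
_==_ : ∀ {n} → Fin n → Fin n → Bool
zero  == zero  = true
suc x == suc y = x == y
_     == _     = false

==-refl : ∀ {n} (x : Fin n) → (x == x) ≡ true
==-refl zero    = refl
==-refl (suc x) = ==-refl x

_∉ᵇ_ : ∀ {n} → Fin n → List (Fin n) → Bool
x ∉ᵇ []       = true
x ∉ᵇ (y ∷ ys) = if x == y then false else x ∉ᵇ ys

disjoint : ∀ {n} → List (Fin n) → List (Fin n) → Bool
disjoint []       ys = true
disjoint (x ∷ xs) ys = if x ∉ᵇ ys then disjoint xs ys else false

∉ᵇ-sound : ∀ {n} {x : Fin n} {ys} → T (x ∉ᵇ ys) → x ∉ ys
∉ᵇ-sound {x = x} h (here refl) rewrite ==-refl x = h
∉ᵇ-sound {x = x} {y ∷ ys} h (there x∈) with x == y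
... | false = ∉ᵇ-sound {ys = ys} h x∈

disjoint-sound : ∀ {n} {xs ys : List (Fin n)} → T (disjoint xs ys) →
                 ∀ {x y} → x ∈ xs → y ∈ ys → x ≢ y
disjoint-sound {xs = x ∷ xs} {ys} h x∈ y∈ refl with x ∉ᵇ ys in eq
disjoint-sound {xs = x ∷ xs} {ys} h (here refl) y∈ refl
  | true = ∉ᵇ-sound {ys = ys} (subst T (sym eq) _) y∈
disjoint-sound {xs = x ∷ xs} {ys} h (there x∈)  y∈ refl
  | true = disjoint-sound {xs = xs} {ys} h x∈ y∈ refl

-- At most two colors are seen at a boundary vertex. Enlarging them to exactly two only strengthens
-- the constraint and leaves six cases.
pairs : List (List Color)
pairs = (0F ∷ 1F ∷ []) ∷ (0F ∷ 2F ∷ []) ∷ (0F ∷ 3F ∷ []) ∷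
        (1F ∷ 2F ∷ []) ∷ (1F ∷ 3F ∷ []) ∷ (2F ∷ 3F ∷ []) ∷ []

abstract
  covered-by-pair : ∀ x y → Any (λ P → x ∈ P × y ∈ P) pairs
  covered-by-pair = toWitness {a? = Fin.all? λ x → Fin.all? λ y →
    Any.any? (λ P → (x ∈ᶜ? P) ×-dec (y ∈ᶜ? P)) pairs} _

abstract
  color-outside-pair : All (λ P → ∃[ x ] T (disjoint (x ∷ []) P)) pairs
  color-outside-pair = toWitness {a? = All.all? (λ P → Fin.any? λ x → T? _) pairs} _

-- In a triangle `y`, `a`, `b`, the third edge at `y` has color `g` and its outer end sees `P`; `pa`
-- and `pb` are pendant colors. There is one condition for each edge: the third edge, `y a`, `y b`
-- and `a b`.
TriangleColoring : (P : List Color) (g : Color) → Set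
TriangleColoring P g =
  ∃[ ya ] ∃[ yb ] T (disjoint (ya ∷ yb ∷ []) P) ×
  ∃[ ab ] ∃[ pa ] T (disjoint (ab ∷ pa ∷ []) (yb ∷ g ∷ [])) ×
  ∃[ pb ] T (disjoint (ab ∷ pb ∷ []) (ya ∷ g ∷ [])) × T (disjoint (ya ∷ pa ∷ []) (yb ∷ pb ∷ []))

abstract
  triangle-coloring : All (λ P → ∀ g → TriangleColoring P g) pairs
  triangle-coloring = toWitness {a? = All.all? (λ P → Fin.all? λ g →
    Fin.any? λ ya → Fin.any? λ yb → T? _ ×-dec (Fin.any? λ ab → Fin.any? λ pa → T? _ ×-dec
    (Fin.any? λ pb → T? _ ×-dec T? _))) pairs} _

-- On a path of three 2-vertices, `g` and `h` color the two outgoing edges, whose outer ends see `P`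
-- and `Q`. The inner edges get `e₁` and `e₂`, the pendant edges `p₁`, `p₂`, `p₃`.
PathColoring : (P Q : List Color) (g h : Color) → Set
PathColoring P Q g h =
  ∃[ e₁ ] ∃[ p₁ ] T (disjoint (e₁ ∷ p₁ ∷ []) P) ×
  ∃[ e₂ ] ∃[ p₃ ] T (disjoint (e₂ ∷ p₃ ∷ []) Q) ×
  ∃[ p₂ ] T (disjoint (g ∷ p₁ ∷ []) (e₂ ∷ p₂ ∷ [])) × T (disjoint (e₁ ∷ p₂ ∷ []) (h ∷ p₃ ∷ []))

abstract
  path-coloring : All (λ P → All (λ Q → ∀ g h → PathColoring P Q g h) pairs) pairs
  path-coloring = toWitness {a? = All.all? (λ P → All.all? (λ Q → Fin.all? λ g → Fin.all? λ h →
    Fin.any? λ e₁ → Fin.any? λ p₁ → T? _ ×-dec (Fin.any? λ e₂ → Fin.any? λ p₃ → T? _ ×-dec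
    (Fin.any? λ p₂ → T? _ ×-dec T? _))) pairs) pairs} _

colors : List Color
colors = allFin 4

-- (y , s , p) are the colors of the edge from the center of the spider to a neighbor x, of the
-- other edge at x, and of the pendant edge at x.
Arm : Set
Arm = Color × Color × Color

triples : List Arm
triples = cartesianProduct colors (cartesianProduct colors colors)

-- At the far vertex of the arm, `g` is the color of the outgoing edge and `p′` that of the pendant
-- edge. The two tests belong to the outgoing edge and to the edge of color `s`.
armColoring : (g : Color) (P : List Color) → Arm → Color → Bool
armColoring g P (y , s , p) p′ = disjoint (s ∷ p′ ∷ []) P ∧ disjoint (y ∷ p ∷ []) (g ∷ p′ ∷ [])

arms : Color → List Color → List Arm
arms g P = filterᵇ (λ a → any (armColoring g P a) colors) triples

-- Towards the center only `y` and the set of `s` and `p` matter, so an arm showing two colors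
-- yields to one with the same `y` that shows just one of them. This shortens the search; soundness
-- only uses that what remains is a sublist of `arms`.
irredundant : List Arm → Arm → Bool
irredundant as (y , s , p) = (s == p) ∨
  not (any (λ (y′ , s′ , p′) → (y == y′) ∧ ((s′ == p′) ∧ ((s′ == s) ∨ (s′ == p)))) as)

minimalArms : Color → List Color → List Arm
minimalArms g P = filterᵇ (irredundant (arms g P)) (arms g P)

-- The colors of the edge from the center to the third neighbor and of the pendant edge there.
legs : List Color → List (Color × Color)
legs P = filterᵇ (λ (y , p) → disjoint (y ∷ p ∷ []) P) (cartesianProduct colors colors)

-- The conditions of `spiderColoring` between the two arms alone, tested before the search over the
-- third leg.
compatible : Arm → Arm → Bool
compatible (ya , sa , pa) (yb , sb , pb) =
  disjoint (sa ∷ pa ∷ []) (yb ∷ []) ∧ disjoint (sb ∷ pb ∷ []) (ya ∷ [])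

-- One condition for each of the three edges at the center; `g` is the color of the outgoing edge at
-- the third neighbor.
spiderColoring : (g : Color) → Arm → Arm → Color × Color → Bool
spiderColoring g (ya , sa , pa) (yb , sb , pb) (yc , pc) =
  disjoint (yb ∷ yc ∷ []) (sa ∷ pa ∷ []) ∧
  disjoint (ya ∷ yc ∷ []) (sb ∷ pb ∷ []) ∧
  disjoint (ya ∷ yb ∷ []) (g ∷ pc ∷ [])

allArms : List (List Arm)
allArms = map (λ (g , P) → minimalArms g P) (cartesianProduct colors pairs)

allLegs : List (Color × List (Color × Color))
allLegs = map (λ (g , P) → g , legs P) (cartesianProduct colors pairs)

jointlyColorable : List (Color × Color) → Color → Arm → Arm → Bool
jointlyColorable cs g a b = compatible a b ∧ any (spiderColoring g a b) cs

spiderColorable : List Arm → List Arm → Color × List (Color × Color) → Bool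
spiderColorable as bs (g , cs) = any (λ a → any (jointlyColorable cs g a) bs) as

allLegsColorable : List Arm → List Arm → Bool
allLegsColorable as bs = all (spiderColorable as bs) allLegs

allArmsColorable : List Arm → Bool
allArmsColorable as = all (allLegsColorable as) allArms

-- A computation over all 24³ boundary conditions; under T instead of _≡ true it is far slower.
abstract
  spidersColorable : all allArmsColorable allArms ≡ true
  spidersColorable = refl

all-sound : ∀ {A : Set} (f : A → Bool) xs → all f xs ≡ true → ∀ {x} → x ∈ xs → f x ≡ true
all-sound f xs h x∈ = Equivalence.to T-≡ (All.lookup (All.all⁺ f xs (Equivalence.from T-≡ h)) x∈)

any-sound : ∀ {A : Set} (f : A → Bool) xs → T (any f xs) → ∃[ x ] x ∈ xs × T (f x)
any-sound f xs h = find (Any.any⁻ f xs h)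

arm∈ : ∀ {P} → P ∈ pairs → ∀ g → minimalArms g P ∈ allArms
arm∈ P∈ g = ∈-map⁺ (λ (g , P) → minimalArms g P) (∈-cartesianProduct⁺ (∈-allFin g) P∈)

∈-minimalArms⁻ : ∀ g P {a} → a ∈ minimalArms g P → ∃[ p ] T (armColoring g P a p)
∈-minimalArms⁻ g P {a} a∈ =
  let a∈arms , _ = ∈-filter⁻ (T? ∘ irredundant (arms g P)) {xs = arms g P} a∈
      p , _ , h = any-sound (armColoring g P a) colors
                    (proj₂ (∈-filter⁻ (λ a → T? (any (armColoring g P a) colors))
                       {xs = triples} a∈arms))
  in p , h

-- The pairs `A`, `B`, `C` are seen at the outer ends of the three outgoing edges, whose colors are
-- `α`, `β`, `γ`. The eight conditions belong to the five edges of the spider and these three; `pa′`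
-- and `pb′` are the pendant colors at the far ends of the arms.
SpiderColoring : (A B C : List Color) (α β γ : Color) → Set
SpiderColoring A B C α β γ =
  ∃[ ya ] ∃[ sa ] ∃[ pa ] ∃[ pa′ ] ∃[ yb ] ∃[ sb ] ∃[ pb ] ∃[ pb′ ] ∃[ yc ] ∃[ pc ]
  (T (disjoint (sa ∷ pa′ ∷ []) A) × T (disjoint (ya ∷ pa ∷ []) (α ∷ pa′ ∷ []))) ×
  (T (disjoint (sb ∷ pb′ ∷ []) B) × T (disjoint (yb ∷ pb ∷ []) (β ∷ pb′ ∷ []))) ×
  T (disjoint (yc ∷ pc ∷ []) C) ×
  T (disjoint (yb ∷ yc ∷ []) (sa ∷ pa ∷ [])) ×
  T (disjoint (ya ∷ yc ∷ []) (sb ∷ pb ∷ [])) ×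
  T (disjoint (ya ∷ yb ∷ []) (γ ∷ pc ∷ []))

spider-coloring : ∀ {A B C} → A ∈ pairs → B ∈ pairs → C ∈ pairs → ∀ α β γ →
  SpiderColoring A B C α β γ
spider-coloring {A} {B} {C} A∈ B∈ C∈ α β γ =
  let as = minimalArms α A
      bs = minimalArms β B
      h₁ = all-sound allArmsColorable allArms spidersColorable (arm∈ A∈ α)
      h₂ = all-sound (allLegsColorable as) allArms h₁ (arm∈ B∈ β)
      h₃ = all-sound (spiderColorable as bs) allLegs h₂
             (∈-map⁺ (λ (g , P) → g , legs P) (∈-cartesianProduct⁺ (∈-allFin γ) C∈))
      a@(ya , sa , pa) , a∈ , h₄ =
        any-sound (λ a → any (jointlyColorable (legs C) γ a) bs) as (Equivalence.from T-≡ h₃)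
      b@(yb , sb , pb) , b∈ , h₅ = any-sound (jointlyColorable (legs C) γ a) bs h₄
      _ , h₆ = Equivalence.to (T-∧ {compatible a b}) h₅
      (yc , pc) , c∈ , h₇ = any-sound (spiderColoring γ a b) (legs C) h₆
      ha , h₈ = Equivalence.to (T-∧ {disjoint (yb ∷ yc ∷ []) (sa ∷ pa ∷ [])}) h₇
      hb , hc = Equivalence.to (T-∧ {disjoint (ya ∷ yc ∷ []) (sb ∷ pb ∷ [])}) h₈
      pa′ , hpa = ∈-minimalArms⁻ α A a∈
      pb′ , hpb = ∈-minimalArms⁻ β B b∈
      _ , hleg = ∈-filter⁻ (λ (y , p) → T? (disjoint (y ∷ p ∷ []) C))
                   {xs = cartesianProduct colors colors} c∈
  in ya , sa , pa , pa′ , yb , sb , pb , pb′ , yc , pc ,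
     Equivalence.to (T-∧ {disjoint (sa ∷ pa′ ∷ []) A}) hpa ,
     Equivalence.to (T-∧ {disjoint (sb ∷ pb′ ∷ []) B}) hpb ,
     hleg , ha , hb , hc

-- Colorings with pendant edges

position : ∀ {n} → List (Fin n) → Fin n → Maybe ℕ
position []       v = nothing
position (t ∷ ts) v = if does (v Fin.≟ t) then just 0 else Maybe.map suc (position ts v)

position-lookup : ∀ {n} {ts : List (Fin n)} → Unique ts →
                  ∀ i → position ts (List.lookup ts i) ≡ just (toℕ i)
position-lookup {ts = t ∷ ts} _ zero =
  cong (λ b → if b then just 0 else Maybe.map suc (position ts t)) (dec-true (t Fin.≟ t) refl)
position-lookup {ts = t ∷ ts} (t∉ ∷ uniq) (suc i) = trans
  (cong (λ b → if b then just 0 else Maybe.map suc (position ts (List.lookup ts i)))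
    (dec-false (List.lookup ts i Fin.≟ t) (All.lookup t∉ (∈-lookup i) ∘ sym)))
  (cong (Maybe.map suc) (position-lookup uniq i))

position-∉ : ∀ {n} {ts : List (Fin n)} {v} → v ∉ ts → position ts v ≡ nothing
position-∉ {ts = []} v∉ = refl
position-∉ {ts = t ∷ ts} {v} v∉ = trans
  (cong (λ b → if b then just 0 else Maybe.map suc (position ts v))
    (dec-false (v Fin.≟ t) (v∉ ∘ here)))
  (cong (Maybe.map suc) (position-∉ (v∉ ∘ there)))

position-∈ : ∀ {n} {ts : List (Fin n)} {v} → v ∈ ts → ∃[ i ] position ts v ≡ just i
position-∈ {ts = t ∷ ts} {v} v∈ with v Fin.≟ t | v∈
... | yes _   | _          = 0 , refl
... | no v≢t  | here v≡t   = contradiction v≡t v≢t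
... | no _    | there v∈ts = let i , eq = position-∈ v∈ts in suc i , cong (Maybe.map suc) eq

-- A record, so that the vertex and its index can be inferred from a proof.
record At {n} (ts : List (Fin n)) (i : ℕ) (v : Fin n) : Set where
  constructor at
  field found : position ts v ≡ just i

at-lookup : ∀ {n} {ts : List (Fin n)} → Unique ts → ∀ i → At ts (toℕ i) (List.lookup ts i)
at-lookup uniq i = at (position-lookup uniq i)

entry : List Color → ℕ → Color
entry []       _       = 0F
entry (x ∷ xs) zero    = x
entry (x ∷ xs) (suc i) = entry xs i

module Pendant (G : Graph) (subcubic : Subcubic G) where

  open Graph G
  open Induced G
  open Subcubic-induced G subcubic

  module _ (S : Subset n) (color : Vertex → Vertex → Color) (pendant : Vertex → Color) where

    -- The colors at `b` on edges other than `b c`, the virtual pendant edge included. They are the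
    -- ones that conflict, across `b c`, with those at `c`.
    data Seen (b c : Vertex) : Color → Set where
      along : ∀ {a} → S ⊢ b ~ a → a ≢ c → Seen b c (color b a)
      hung  : deg S b ≤ 2 → Seen b c (pendant b)

    Sees : Vertex → Vertex → List Color → Set
    Sees b c xs = ∀ {x} → Seen b c x → x ∈ xs

    ClashFree : Vertex → Vertex → Set
    ClashFree b c = ∀ {x y} → Seen b c x → Seen c b y → x ≢ y

    clashFree-sym : ∀ {b c} → ClashFree b c → ClashFree c b
    clashFree-sym free s t x≡y = free t s (sym x≡y)

    clashFree : ∀ {b c xs ys} → Sees b c xs → T (disjoint xs ys) → Sees c b ys → ClashFree b c
    clashFree {xs = xs} {ys} ⊆xs disj ⊆ys s t = disjoint-sound {xs = xs} {ys} disj (⊆xs s) (⊆ys t)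

    sees-leaf : ∀ {t c π} → (∀ {a} → S ⊢ t ~ a → a ≡ c) → pendant t ≡ π → Sees t c (π ∷ [])
    sees-leaf cover refl (along ta a≢c) = contradiction (cover ta) a≢c
    sees-leaf cover refl (hung _)       = here refl

    sees-2 : ∀ {t c w α π} → (∀ {a} → S ⊢ t ~ a → a ≡ c ⊎ a ≡ w) → color t w ≡ α → pendant t ≡ π →
             Sees t c (α ∷ π ∷ [])
    sees-2 cover refl refl (hung _) = there (here refl)
    sees-2 cover refl refl (along ta a≢c) with cover ta
    ... | inj₁ a≡c  = contradiction a≡c a≢c
    ... | inj₂ refl = here refl

    sees-3 : ∀ {t c w z α β} → deg S t ≡ 3 → (∀ {a} → S ⊢ t ~ a → a ≡ c ⊎ a ≡ w ⊎ a ≡ z) →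
             color t w ≡ α → color t z ≡ β → Sees t c (α ∷ β ∷ [])
    sees-3 deg≡3 cover refl refl (hung deg≤2) =
      case subst (_≤ 2) deg≡3 deg≤2 of λ { (s≤s (s≤s ())) }
    sees-3 deg≡3 cover refl refl (along ta a≢c) with cover ta
    ... | inj₁ a≡c         = contradiction a≡c a≢c
    ... | inj₂ (inj₁ refl) = here refl
    ... | inj₂ (inj₂ refl) = there (here refl)

  -- A 4-coloring in which each vertex of degree at most 2 also carries a virtual pendant
  -- edge; when a set T is deleted, the pendant color at a vertex outside T is kept in
  -- reserve for the edges that join it to T.
  record PendantColoring (S : Subset n) : Set where
    field
      color     : Vertex → Vertex → Color
      color-sym : ∀ u v → color u v ≡ color v u
      pendant   : Vertex → Color
      valid     : ∀ {b c} → S ⊢ b ~ c → ClashFree S color pendant b c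

  open PendantColoring

  pendant⇒proper : ∀ {S} → PendantColoring S → HasProper 4 S
  pendant⇒proper P = color P , color-sym P , λ {a} {b} ab bc cd a≢c b≢d eq →
    valid P bc (along (~-sym ab) a≢c) (along cd (b≢d ∘ sym)) (trans (color-sym P b a) eq)

  module Restore (S : Subset n) (T : List Vertex) (P : PendantColoring (S ∖ T)) where

    module _ (inner : ℕ → Color) where

      -- An edge inside `T` is looked up by the sum of the positions of its ends; each `T` below is
      -- ordered so that its edges have different sums. An edge leaving `T` takes the pendant color
      -- of its outer end.
      glue : Maybe ℕ → Maybe ℕ → Vertex → Vertex → Color
      glue (just i) (just j) u v = inner (i + j)
      glue (just i) nothing  u v = pendant P v
      glue nothing  (just j) u v = pendant P u
      glue nothing  nothing  u v = color P u v

      color′ : Vertex → Vertex → Color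
      color′ u v = glue (position T u) (position T v) u v

      glue-sym : ∀ i j u v → glue i j u v ≡ glue j i v u
      glue-sym (just i) (just j) u v = cong inner (ℕ.+-comm i j)
      glue-sym (just i) nothing  u v = refl
      glue-sym nothing  (just j) u v = refl
      glue-sym nothing  nothing  u v = color-sym P u v

    pendant′ : (ℕ → Color) → Vertex → Color
    pendant′ hanging u = Maybe.maybe hanging (pendant P u) (position T u)

    -- The new color of `c a` for `c` outside `T`. It does not depend on `inner`, so boundary
    -- conditions are known before the new colors are chosen.
    outward : Vertex → Vertex → Color
    outward c a = Maybe.maybe (λ _ → pendant P c) (color P c a) (position T a)

    module _ {inner : ℕ → Color} where

      color′-outward : ∀ {c a} → c ∉ T → color′ inner c a ≡ outward c a
      color′-outward {c} {a} c∉ rewrite position-∉ c∉ with position T a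
      ... | just _  = refl
      ... | nothing = refl

      color′-inner : ∀ {u v i j} → At T i u → At T j v →
                     color′ inner u v ≡ inner (i + j)
      color′-inner (at eq₁) (at eq₂) = cong₂ (λ i j → glue inner i j _ _) eq₁ eq₂

      color′-boundary : ∀ {u v i} → At T i u → v ∉ T → color′ inner u v ≡ pendant P v
      color′-boundary (at eq) v∉ = cong₂ (λ i j → glue inner i j _ _) eq (position-∉ v∉)

    module _ {hanging : ℕ → Color} where

      pendant′-inside : ∀ {u i} → At T i u → pendant′ hanging u ≡ hanging i
      pendant′-inside (at eq) = cong (Maybe.maybe hanging _) eq

      pendant′-outside : ∀ {u} → u ∉ T → pendant′ hanging u ≡ pendant P u
      pendant′-outside u∉ = cong (Maybe.maybe hanging _) (position-∉ u∉)

    Boundary : Vertex → Vertex → Set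
    Boundary t c = ∃[ B ] B ∈ pairs ×
      (∀ {inner hanging} → Sees S (color′ inner) (pendant′ hanging) c t B)

    -- Besides the edge to `t`, the vertex `c` has either two edges, and then no pendant edge, or at
    -- most one edge and its pendant edge. Hence it shows at most two colors.
    boundary : ∀ {t c} → c ∉ T → S ⊢ t ~ c → Boundary t c
    boundary {t} {c} c∉ tc = bound (pick (N-unique S c) (∈-N⁺ (~-sym tc)))
      where
      within : ∀ x y → (∀ {inner hanging z} → Seen S (color′ inner) (pendant′ hanging) c t z →
               z ≡ x ⊎ z ≡ y) → Boundary t c
      within x y seen =
        let B , B∈ , x∈ , y∈ = find (covered-by-pair x y) in
        B , B∈ , λ {inner} {hanging} s →
          case seen {inner} {hanging} s of λ { (inj₁ refl) → x∈ ; (inj₂ refl) → y∈ }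

      bound : (∃[ ys ] length (N S c) ≡ suc (length ys) × Unique ys ×
                (∀ {y} → y ∈ ys → y ∈ N S c × y ≢ t) × (∀ {y} → y ∈ N S c → y ≡ t ⊎ y ∈ ys)) →
              Boundary t c
      bound ([] , _ , _ , _ , cover) = within (pendant P c) (pendant P c) λ where
        (hung _)       → inj₁ (pendant′-outside c∉)
        (along ca a≢t) → case cover (∈-N⁺ ca) of λ where
          (inj₁ a≡t) → contradiction a≡t a≢t
      bound (a ∷ [] , _ , _ , _ , cover) = within (outward c a) (pendant P c) λ where
        (hung _)       → inj₂ (pendant′-outside c∉)
        (along ca a≢t) → case cover (∈-N⁺ ca) of λ where
          (inj₁ a≡t)         → contradiction a≡t a≢t
          (inj₂ (here refl)) → inj₁ (color′-outward c∉)
      bound (a ∷ b ∷ [] , deg≡3 , _ , _ , cover) = within (outward c a) (outward c b) λ where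
        (hung deg≤2)   → case subst (_≤ 2) deg≡3 deg≤2 of λ { (s≤s (s≤s ())) }
        (along ca a≢t) → case cover (∈-N⁺ ca) of λ where
          (inj₁ a≡t)                 → contradiction a≡t a≢t
          (inj₂ (here refl))         → inj₁ (color′-outward c∉)
          (inj₂ (there (here refl))) → inj₂ (color′-outward c∉)
      bound (_ ∷ _ ∷ _ ∷ _ , deg≡ , _) =
        case subst (_≤ 3) deg≡ (deg≤3 S c) of λ { (s≤s (s≤s (s≤s ()))) }

    -- Only edges meeting `T` have to be checked. Across any other edge, all colors now seen were
    -- already seen before `T` was put back.
    restore : ∀ inner hanging →
      (∀ {t c} → t ∈ T → S ⊢ t ~ c → ClashFree S (color′ inner) (pendant′ hanging) t c) →
      PendantColoring S
    restore inner hanging free = record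
      { color     = color′ inner
      ; color-sym = λ u v → glue-sym inner (position T u) (position T v) u v
      ; pendant   = pendant′ hanging
      ; valid     = valid′
      }
      where
      Seen′ = Seen S (color′ inner) (pendant′ hanging)

      ∖⊆ : ∀ {v} → v ∈ˢ S ∖ T → v ∈ˢ S
      ∖⊆ = proj₁ ∘ ∈-∖⁻ {T = T}

      was-seen : ∀ {b c x} → b ∉ T → S ⊢ b ~ c → Seen′ b c x →
                 Seen (S ∖ T) (color P) (pendant P) b c x
      was-seen {b} b∉ bc (hung deg≤2) =
        subst (Seen _ _ _ b _) (sym (pendant′-outside b∉)) (hung (ℕ.≤-trans (deg-mono ∖⊆ b) deg≤2))
      was-seen {b} {c} b∉ bc (along {a} ba@(b∈ , a∈ , adj) a≢c) =
        subst (Seen _ _ _ b c) (sym (color′-outward b∉))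
        (case Any.any? (a Fin.≟_) T of λ where
          -- Without its neighbor `a`, the vertex `b` had degree at most 2, so the color now on
          -- `b a` was then visible on its pendant edge.
          (yes a∈T) → subst (Seen _ _ _ b c)
            (sym (cong (Maybe.maybe (λ _ → pendant P b) (color P b a)) (proj₂ (position-∈ a∈T))))
            (hung (ℕ.s≤s⁻¹ (ℕ.≤-trans
              (deg-mono-< ∖⊆ ba (λ a∈′ → proj₂ (∈-∖⁻ {T = T} a∈′) a∈T)) (deg≤3 S b))))
          (no a∉T) → subst (Seen _ _ _ b c)
            (sym (cong (Maybe.maybe (λ _ → pendant P b) (color P b a)) (position-∉ a∉T)))
            (along (∈-∖⁺ b∈ b∉ , ∈-∖⁺ a∈ a∉T , adj) a≢c))

      valid′ : ∀ {b c} → S ⊢ b ~ c → ClashFree S (color′ inner) (pendant′ hanging) b c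
      valid′ {b} {c} bc@(b∈ , c∈ , adj) s t = case Any.any? (b Fin.≟_) T of λ where
        (yes b∈T) → free b∈T bc s t
        (no b∉T)  → case Any.any? (c Fin.≟_) T of λ where
          (yes c∈T) → clashFree-sym S (color′ inner) (pendant′ hanging) (free c∈T (~-sym bc)) s t
          (no c∉T)  → valid P (∈-∖⁺ b∈ b∉T , ∈-∖⁺ c∈ c∉T , adj)
                        (was-seen b∉T bc s) (was-seen c∉T (~-sym bc) t)

rotateˡ : ∀ {A B C : Set} → A ⊎ B ⊎ C → B ⊎ C ⊎ A
rotateˡ (inj₁ x)        = inj₂ (inj₂ x)
rotateˡ (inj₂ (inj₁ x)) = inj₁ x
rotateˡ (inj₂ (inj₂ x)) = inj₂ (inj₁ x)

-- Reducible leaves, paths and triangles for 4 colors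

module Pendant-reductions (G : Graph) (subcubic : Subcubic G) where

  open Graph G
  open Induced G
  open Subcubic-induced G subcubic
  open Pendant G subcubic
  open PendantColoring

  restore-isolated : ∀ {S v} → (∀ {c} → ¬ S ⊢ v ~ c) →
                     PendantColoring (S ∖ (v ∷ [])) → PendantColoring S
  restore-isolated {S} {v} none P =
    Restore.restore S (v ∷ []) P (λ _ → 0F) (λ _ → 0F) λ { (here refl) vc → contradiction vc none }

  -- The edge `v u` takes the pendant color of `u`. The only new choice is the pendant color at `v`,
  -- which must avoid the two colors seen at `u`.
  restore-leaf : ∀ {S v u} → S ⊢ v ~ u → (∀ {c} → S ⊢ v ~ c → c ≡ u) →
                 PendantColoring (S ∖ (v ∷ [])) → PendantColoring S
  restore-leaf {S} {v} {u} vu cover P =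
    restore inner hanging λ { (here refl) vc → free vc (cover vc) }
    where
    open Restore S (v ∷ []) P
    B = boundary (λ { (here u≡v) → ~-≢ vu (sym u≡v) }) vu
    π = All.lookup color-outside-pair (proj₁ (proj₂ B))
    inner hanging : ℕ → Color
    inner   = λ _ → 0F
    hanging = λ _ → proj₁ π

    free : ∀ {c} → S ⊢ v ~ c → c ≡ u → ClashFree S (color′ inner) (pendant′ hanging) v c
    free vc refl = clashFree S _ _
      (sees-leaf S _ _ cover (pendant′-inside (at-lookup {ts = v ∷ []} ([] ∷ []) 0F)))
      (proj₂ π) (proj₂ (proj₂ B))

  -- Nonadjacency of `x₁` and `x₃` puts the outer neighbors `x₀` and `x₄` outside the path. They may
  -- coincide, since `path-coloring` holds for all boundary data.
  restore-path : ∀ {S x₁ x₂ x₃} → S ⊢ x₁ ~ x₂ → S ⊢ x₂ ~ x₃ → x₁ ≢ x₃ → ¬ S ⊢ x₁ ~ x₃ →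
    deg S x₁ ≡ 2 → deg S x₂ ≡ 2 → deg S x₃ ≡ 2 →
    PendantColoring (S ∖ (x₁ ∷ x₂ ∷ x₃ ∷ [])) → PendantColoring S
  restore-path {S} {x₁} {x₂} {x₃} x₁x₂ x₂x₃ x₁≢x₃ x₁≁x₃ deg₁ deg₂ deg₃ P
    with neighbors-of-2 x₁x₂ deg₁ | neighbors-of-2 (~-sym x₂x₃) deg₃
  ... | x₀ , x₁x₀ , x₀≢x₂ , cover₁ | x₄ , x₃x₄ , x₄≢x₂ , cover₃ =
    let B₀@(_ , A∈ , _) = boundary x₀∉ x₁x₀
        B₄@(_ , B∈ , _) = boundary x₄∉ x₃x₄
    in colored B₀ B₄ (All.lookup (All.lookup path-coloring A∈) B∈ (pendant P x₀) (pendant P x₄))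
    where
    D = x₁ ∷ x₂ ∷ x₃ ∷ []
    open Restore S D P

    distinct : Unique D
    distinct = (~-≢ x₁x₂ ∷ x₁≢x₃ ∷ []) ∷ (~-≢ x₂x₃ ∷ []) ∷ [] ∷ []

    at₁ = at-lookup distinct 0F
    at₂ = at-lookup distinct 1F
    at₃ = at-lookup distinct 2F

    x₀∉ : x₀ ∉ D
    x₀∉ (here refl)                 = ~-≢ x₁x₀ refl
    x₀∉ (there (here refl))         = x₀≢x₂ refl
    x₀∉ (there (there (here refl))) = x₁≁x₃ x₁x₀

    x₄∉ : x₄ ∉ D
    x₄∉ (here refl)                 = x₁≁x₃ (~-sym x₃x₄)
    x₄∉ (there (here refl))         = x₄≢x₂ refl
    x₄∉ (there (there (here refl))) = ~-≢ x₃x₄ refl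

    cover₂ : ∀ {c} → S ⊢ x₂ ~ c → c ≡ x₁ ⊎ c ≡ x₃
    cover₂ = two-neighbors deg₂ (~-sym x₁x₂) x₂x₃ (x₁≢x₃ ∘ sym)

    colored : (B₀ : Boundary x₁ x₀) (B₄ : Boundary x₃ x₄) →
      PathColoring (proj₁ B₀) (proj₁ B₄) (pendant P x₀) (pendant P x₄) → PendantColoring S
    colored (_ , _ , sees₀) (_ , _ , sees₄) (e₁ , p₁ , d₁ , e₂ , p₃ , d₂ , p₂ , d₃ , d₄) =
      restore inner hanging free
      where
      inner hanging : ℕ → Color
      -- The edges `x₁ x₂` and `x₂ x₃` have position sums 0 + 1 and 1 + 2; entries 0 and 2 are
      -- fillers.
      inner   = entry (0F ∷ e₁ ∷ 0F ∷ e₂ ∷ [])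
      hanging = entry (p₁ ∷ p₂ ∷ p₃ ∷ [])

      Free : Vertex → Vertex → Set
      Free = ClashFree S (color′ inner) (pendant′ hanging)

      free₁₀ : Free x₁ x₀
      free₁₀ = clashFree S _ _
        (sees-2 S _ _ (swap ∘ cover₁) (color′-inner at₁ at₂) (pendant′-inside at₁)) d₁ sees₀

      free₁₂ : Free x₁ x₂
      free₁₂ = clashFree S _ _
        (sees-2 S _ _ cover₁ (color′-boundary at₁ x₀∉) (pendant′-inside at₁)) d₃
        (sees-2 S _ _ cover₂ (color′-inner at₂ at₃) (pendant′-inside at₂))

      free₂₃ : Free x₂ x₃
      free₂₃ = clashFree S _ _
        (sees-2 S _ _ (swap ∘ cover₂) (color′-inner at₂ at₁) (pendant′-inside at₂)) d₄
        (sees-2 S _ _ cover₃ (color′-boundary at₃ x₄∉) (pendant′-inside at₃))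

      free₃₄ : Free x₃ x₄
      free₃₄ = clashFree S _ _
        (sees-2 S _ _ (swap ∘ cover₃) (color′-inner at₃ at₂) (pendant′-inside at₃)) d₂ sees₄

      free : ∀ {t c} → t ∈ D → S ⊢ t ~ c → Free t c
      free (here refl) tc with cover₁ tc
      ... | inj₁ refl = free₁₂
      ... | inj₂ refl = free₁₀
      free (there (here refl)) tc with cover₂ tc
      ... | inj₁ refl = clashFree-sym S _ _ free₁₂
      ... | inj₂ refl = free₂₃
      free (there (there (here refl))) tc with cover₃ tc
      ... | inj₁ refl = clashFree-sym S _ _ free₂₃
      ... | inj₂ refl = free₃₄

  restore-triangle : ∀ {S y a b} → S ⊢ y ~ a → S ⊢ y ~ b → S ⊢ a ~ b →
    deg S a ≡ 2 → deg S b ≡ 2 → deg S y ≡ 2 ⊎ deg S y ≡ 3 →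
    PendantColoring (S ∖ (y ∷ a ∷ b ∷ [])) → PendantColoring S
  restore-triangle {S} {y} {a} {b} y~a y~b a~b dega degb degy P = by-degree degy
    where
    D = y ∷ a ∷ b ∷ []
    open Restore S D P

    distinct : Unique D
    distinct = (~-≢ y~a ∷ ~-≢ y~b ∷ []) ∷ (~-≢ a~b ∷ []) ∷ [] ∷ []

    at-y = at-lookup distinct 0F
    at-a = at-lookup distinct 1F
    at-b = at-lookup distinct 2F

    cover-a : ∀ {c} → S ⊢ a ~ c → c ≡ y ⊎ c ≡ b
    cover-a = two-neighbors dega (~-sym y~a) a~b (~-≢ y~b ∘ sym)

    cover-b : ∀ {c} → S ⊢ b ~ c → c ≡ y ⊎ c ≡ a
    cover-b = two-neighbors degb (~-sym y~b) (~-sym a~b) (~-≢ y~a ∘ sym)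

    -- r is the color of the third edge at y, or of the pendant edge if y has degree 2.
    module Colors (r ya yb ab pa pb : Color)
                  (d₂ : T (disjoint (ab ∷ pa ∷ []) (yb ∷ r ∷ [])))
                  (d₃ : T (disjoint (ab ∷ pb ∷ []) (ya ∷ r ∷ [])))
                  (d₄ : T (disjoint (ya ∷ pa ∷ []) (yb ∷ pb ∷ []))) where

      inner hanging : ℕ → Color
      inner   = entry (0F ∷ ya ∷ yb ∷ ab ∷ [])
      hanging = entry (r ∷ pa ∷ pb ∷ [])

      Free : Vertex → Vertex → Set
      Free = ClashFree S (color′ inner) (pendant′ hanging)

      SeesHere : Vertex → Vertex → List Color → Set
      SeesHere = Sees S (color′ inner) (pendant′ hanging)

      assemble : SeesHere y a (yb ∷ r ∷ []) → SeesHere y b (ya ∷ r ∷ []) →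
                 (∀ {c} → S ⊢ y ~ c → c ≡ a ⊎ c ≡ b ⊎ Free y c) → PendantColoring S
      assemble sees-ya sees-yb cover-y = restore inner hanging free
        where
        free-ay : Free a y
        free-ay = clashFree S _ _
          (sees-2 S _ _ cover-a (color′-inner at-a at-b) (pendant′-inside at-a)) d₂ sees-ya

        free-by : Free b y
        free-by = clashFree S _ _
          (sees-2 S _ _ cover-b (color′-inner at-b at-a) (pendant′-inside at-b)) d₃ sees-yb

        free-ab : Free a b
        free-ab = clashFree S _ _
          (sees-2 S _ _ (swap ∘ cover-a) (color′-inner at-a at-y) (pendant′-inside at-a)) d₄
          (sees-2 S _ _ (swap ∘ cover-b) (color′-inner at-b at-y) (pendant′-inside at-b))

        free : ∀ {t c} → t ∈ D → S ⊢ t ~ c → Free t c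
        free (here refl) tc with cover-y tc
        ... | inj₁ refl           = clashFree-sym S _ _ free-ay
        ... | inj₂ (inj₁ refl)    = clashFree-sym S _ _ free-by
        ... | inj₂ (inj₂ free-yc) = free-yc
        free (there (here refl)) tc with cover-a tc
        ... | inj₁ refl = free-ay
        ... | inj₂ refl = free-ab
        free (there (there (here refl))) tc with cover-b tc
        ... | inj₁ refl = free-by
        ... | inj₂ refl = clashFree-sym S _ _ free-ab

    by-degree : deg S y ≡ 2 ⊎ deg S y ≡ 3 → PendantColoring S
    -- Nothing lies beyond the triangle here, so the pair and the color `0F` are arbitrary and the
    -- condition on the outgoing edge is dropped.
    by-degree (inj₁ deg≡2) with All.lookup triangle-coloring (here refl) 0F
    ... | ya , yb , _ , ab , pa , d₂ , pb , d₃ , d₄ =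
      assemble (sees-2 S _ _ cover-y (color′-inner at-y at-b) (pendant′-inside at-y))
               (sees-2 S _ _ (swap ∘ cover-y) (color′-inner at-y at-a) (pendant′-inside at-y))
               (map₂ inj₁ ∘ cover-y)
      where
      open Colors 0F ya yb ab pa pb d₂ d₃ d₄
      cover-y : ∀ {c} → S ⊢ y ~ c → c ≡ a ⊎ c ≡ b
      cover-y = two-neighbors deg≡2 y~a y~b (~-≢ a~b ∘ sym)
    by-degree (inj₂ deg≡3) with third-neighbor deg≡3 y~a y~b (~-≢ a~b ∘ sym)
    ... | c , y~c , c≢a , c≢b , cover-y =
      colored (boundary c∉ y~c)
      where
      c∉ : c ∉ D
      c∉ (here refl)                 = ~-≢ y~c refl
      c∉ (there (here refl))         = c≢a refl
      c∉ (there (there (here refl))) = c≢b refl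

      colored : Boundary y c → PendantColoring S
      colored (_ , A∈ , sees-c) with All.lookup triangle-coloring A∈ (pendant P c)
      ... | ya , yb , d₁ , ab , pa , d₂ , pb , d₃ , d₄ =
        assemble (sees-3 S _ _ deg≡3 cover-y (color′-inner at-y at-b) (color′-boundary at-y c∉))
                 (sees-3 S _ _ deg≡3 (map₂ swap ∘ rotateˡ ∘ cover-y)
                   (color′-inner at-y at-a) (color′-boundary at-y c∉))
                 (λ yd → map₂ (map₂ λ { refl → free-yc }) (cover-y yd))
        where
        open Colors (pendant P c) ya yb ab pa pb d₂ d₃ d₄

        free-yc : Free y c
        free-yc = clashFree S _ _
          (sees-3 S _ _ deg≡3 (rotateˡ ∘ rotateˡ ∘ cover-y)
            (color′-inner at-y at-a) (color′-inner at-y at-b)) d₁ sees-c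

-- The reducible spider for 4 colors

module Spider (G : Graph) (subcubic : Subcubic G) where

  open Graph G
  open Induced G
  open Subcubic-induced G subcubic
  open Pendant G subcubic
  open PendantColoring

  -- Excluding the other configurations makes the six vertices distinct, without further edges among
  -- them, so `a₃`, `b₃` and `c₂` lie outside. These three may coincide, as `spider-coloring` allows
  -- all boundary data.
  restore-spider : ∀ {S} →
    (∀ {u v w} → S ⊢ u ~ v → S ⊢ u ~ w → S ⊢ v ~ w → deg S v ≡ 2 → deg S w ≢ 2) →
    (∀ {u v w} → S ⊢ u ~ v → S ⊢ v ~ w → u ≢ w → deg S u ≡ 2 → deg S v ≡ 2 → deg S w ≢ 2) →
    ∀ {y a b c a₂ b₂} → S ⊢ y ~ a → S ⊢ y ~ b → S ⊢ y ~ c → a ≢ b → a ≢ c → b ≢ c →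
    S ⊢ a ~ a₂ → S ⊢ b ~ b₂ → a₂ ≢ y → b₂ ≢ y →
    deg S y ≡ 3 → deg S a ≡ 2 → deg S b ≡ 2 → deg S c ≡ 2 → deg S a₂ ≡ 2 → deg S b₂ ≡ 2 →
    PendantColoring (S ∖ (y ∷ a ∷ b ∷ c ∷ a₂ ∷ b₂ ∷ [])) → PendantColoring S
  restore-spider {S} no-triangle no-path {y} {a} {b} {c} {a₂} {b₂}
    y~a y~b y~c a≢b a≢c b≢c a~a₂ b~b₂ a₂≢y b₂≢y degy dega degb degc dega₂ degb₂ P
    with neighbors-of-2 (~-sym a~a₂) dega₂
       | neighbors-of-2 (~-sym b~b₂) degb₂ | neighbors-of-2 (~-sym y~c) degc
  ... | a₃ , a₂~a₃ , a₃≢a , cover-a₂ | b₃ , b₂~b₃ , b₃≢b , cover-b₂ | c₂ , c~c₂ , c₂≢y , cover-c =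
    let B₁@(_ , A∈ , _) = boundary a₃∉ a₂~a₃
        B₂@(_ , B∈ , _) = boundary b₃∉ b₂~b₃
        B₃@(_ , C∈ , _) = boundary c₂∉ c~c₂
    in colored B₁ B₂ B₃ (spider-coloring A∈ B∈ C∈ (pendant P a₃) (pendant P b₃) (pendant P c₂))
    where
    D = y ∷ a ∷ b ∷ c ∷ a₂ ∷ b₂ ∷ []
    open Restore S D P

    a≁b : ¬ S ⊢ a ~ b
    a≁b ab = no-triangle y~a y~b ab dega degb

    a≁c : ¬ S ⊢ a ~ c
    a≁c ac = no-triangle y~a y~c ac dega degc

    b≁c : ¬ S ⊢ b ~ c
    b≁c bc = no-triangle y~b y~c bc degb degc

    a₂≁b : ¬ S ⊢ a₂ ~ b
    a₂≁b a₂b = no-path a~a₂ a₂b a≢b dega dega₂ degb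

    a₂≁c : ¬ S ⊢ a₂ ~ c
    a₂≁c a₂c = no-path a~a₂ a₂c a≢c dega dega₂ degc

    b₂≁a : ¬ S ⊢ b₂ ~ a
    b₂≁a b₂a = no-path b~b₂ b₂a (a≢b ∘ sym) degb degb₂ dega

    b₂≁c : ¬ S ⊢ b₂ ~ c
    b₂≁c b₂c = no-path b~b₂ b₂c b≢c degb degb₂ degc

    a≢b₂ : a ≢ b₂
    a≢b₂ refl = a≁b (~-sym b~b₂)

    b≢a₂ : b ≢ a₂
    b≢a₂ refl = a≁b a~a₂

    c≢a₂ : c ≢ a₂
    c≢a₂ refl = a≁c a~a₂

    c≢b₂ : c ≢ b₂
    c≢b₂ refl = b≁c b~b₂

    a₂≢b₂ : a₂ ≢ b₂
    a₂≢b₂ refl = a₂≁b (~-sym b~b₂)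

    a₂≁b₂ : ¬ S ⊢ a₂ ~ b₂
    a₂≁b₂ a₂b₂ = no-path a~a₂ a₂b₂ a≢b₂ dega dega₂ degb₂

    a₂≁y : ¬ S ⊢ a₂ ~ y
    a₂≁y a₂y = no-triangle y~a (~-sym a₂y) a~a₂ dega dega₂

    b₂≁y : ¬ S ⊢ b₂ ~ y
    b₂≁y b₂y = no-triangle y~b (~-sym b₂y) b~b₂ degb degb₂

    distinct : Unique D
    distinct =
      (~-≢ y~a ∷ ~-≢ y~b ∷ ~-≢ y~c ∷ a₂≢y ∘ sym ∷ b₂≢y ∘ sym ∷ []) ∷
      (a≢b ∷ a≢c ∷ ~-≢ a~a₂ ∷ a≢b₂ ∷ []) ∷
      (b≢c ∷ b≢a₂ ∷ ~-≢ b~b₂ ∷ []) ∷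
      (c≢a₂ ∷ c≢b₂ ∷ []) ∷
      (a₂≢b₂ ∷ []) ∷
      [] ∷ []

    at-y  = at-lookup distinct 0F
    at-a  = at-lookup distinct 1F
    at-b  = at-lookup distinct 2F
    at-c  = at-lookup distinct 3F
    at-a₂ = at-lookup distinct 4F
    at-b₂ = at-lookup distinct 5F

    a₃∉ : a₃ ∉ D
    a₃∉ (here refl)                                         = a₂≁y a₂~a₃
    a₃∉ (there (here refl))                                 = a₃≢a refl
    a₃∉ (there (there (here refl)))                         = a₂≁b a₂~a₃
    a₃∉ (there (there (there (here refl))))                 = a₂≁c a₂~a₃
    a₃∉ (there (there (there (there (here refl)))))         = ~-≢ a₂~a₃ refl
    a₃∉ (there (there (there (there (there (here refl)))))) = a₂≁b₂ a₂~a₃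

    b₃∉ : b₃ ∉ D
    b₃∉ (here refl)                                         = b₂≁y b₂~b₃
    b₃∉ (there (here refl))                                 = b₂≁a b₂~b₃
    b₃∉ (there (there (here refl)))                         = b₃≢b refl
    b₃∉ (there (there (there (here refl))))                 = b₂≁c b₂~b₃
    b₃∉ (there (there (there (there (here refl)))))         = a₂≁b₂ (~-sym b₂~b₃)
    b₃∉ (there (there (there (there (there (here refl)))))) = ~-≢ b₂~b₃ refl

    c₂∉ : c₂ ∉ D
    c₂∉ (here refl)                                         = c₂≢y refl
    c₂∉ (there (here refl))                                 = a≁c (~-sym c~c₂)
    c₂∉ (there (there (here refl)))                         = b≁c (~-sym c~c₂)
    c₂∉ (there (there (there (here refl))))                 = ~-≢ c~c₂ refl
    c₂∉ (there (there (there (there (here refl)))))         = a₂≁c (~-sym c~c₂)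
    c₂∉ (there (there (there (there (there (here refl)))))) = b₂≁c (~-sym c~c₂)

    cover-y : ∀ {d} → S ⊢ y ~ d → d ≡ a ⊎ d ≡ b ⊎ d ≡ c
    cover-y = three-neighbors degy y~a y~b y~c (a≢b ∘ sym) (a≢c ∘ sym) (b≢c ∘ sym)

    cover-a : ∀ {d} → S ⊢ a ~ d → d ≡ y ⊎ d ≡ a₂
    cover-a = two-neighbors dega (~-sym y~a) a~a₂ a₂≢y

    cover-b : ∀ {d} → S ⊢ b ~ d → d ≡ y ⊎ d ≡ b₂
    cover-b = two-neighbors degb (~-sym y~b) b~b₂ b₂≢y

    colored : (B₁ : Boundary a₂ a₃) (B₂ : Boundary b₂ b₃) (B₃ : Boundary c c₂) →
      SpiderColoring (proj₁ B₁) (proj₁ B₂) (proj₁ B₃) (pendant P a₃) (pendant P b₃) (pendant P c₂) →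
      PendantColoring S
    colored (_ , _ , sees-a₃) (_ , _ , sees-b₃) (_ , _ , sees-c₂)
      (ya , sa , pa , pa′ , yb , sb , pb , pb′ , yc , pc ,
       (d₁ , d₂) , (d₃ , d₄) , d₅ , d₆ , d₇ , d₈) =
      restore inner hanging free
      where
      inner hanging : ℕ → Color
      -- Position sums 1, 2, 3 are the edges at `y`; 5 = 1 + 4 is `a a₂` and 7 = 2 + 5 is `b b₂`.
      inner   = entry (0F ∷ ya ∷ yb ∷ yc ∷ 0F ∷ sa ∷ 0F ∷ sb ∷ [])
      hanging = entry (0F ∷ pa ∷ pb ∷ pc ∷ pa′ ∷ pb′ ∷ [])

      Free : Vertex → Vertex → Set
      Free = ClashFree S (color′ inner) (pendant′ hanging)

      free-a₂a₃ : Free a₂ a₃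
      free-a₂a₃ = clashFree S _ _
        (sees-2 S _ _ (swap ∘ cover-a₂) (color′-inner at-a₂ at-a) (pendant′-inside at-a₂))
        d₁ sees-a₃

      free-aa₂ : Free a a₂
      free-aa₂ = clashFree S _ _
        (sees-2 S _ _ (swap ∘ cover-a) (color′-inner at-a at-y) (pendant′-inside at-a)) d₂
        (sees-2 S _ _ cover-a₂ (color′-boundary at-a₂ a₃∉) (pendant′-inside at-a₂))

      free-b₂b₃ : Free b₂ b₃
      free-b₂b₃ = clashFree S _ _
        (sees-2 S _ _ (swap ∘ cover-b₂) (color′-inner at-b₂ at-b) (pendant′-inside at-b₂))
        d₃ sees-b₃

      free-bb₂ : Free b b₂
      free-bb₂ = clashFree S _ _
        (sees-2 S _ _ (swap ∘ cover-b) (color′-inner at-b at-y) (pendant′-inside at-b)) d₄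
        (sees-2 S _ _ cover-b₂ (color′-boundary at-b₂ b₃∉) (pendant′-inside at-b₂))

      free-cc₂ : Free c c₂
      free-cc₂ = clashFree S _ _
        (sees-2 S _ _ (swap ∘ cover-c) (color′-inner at-c at-y) (pendant′-inside at-c)) d₅ sees-c₂

      free-ya : Free y a
      free-ya = clashFree S _ _
        (sees-3 S _ _ degy cover-y (color′-inner at-y at-b) (color′-inner at-y at-c)) d₆
        (sees-2 S _ _ cover-a (color′-inner at-a at-a₂) (pendant′-inside at-a))

      free-yb : Free y b
      free-yb = clashFree S _ _
        (sees-3 S _ _ degy (map₂ swap ∘ rotateˡ ∘ cover-y)
          (color′-inner at-y at-a) (color′-inner at-y at-c)) d₇
        (sees-2 S _ _ cover-b (color′-inner at-b at-b₂) (pendant′-inside at-b))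

      free-yc : Free y c
      free-yc = clashFree S _ _
        (sees-3 S _ _ degy (rotateˡ ∘ rotateˡ ∘ cover-y)
          (color′-inner at-y at-a) (color′-inner at-y at-b)) d₈
        (sees-2 S _ _ cover-c (color′-boundary at-c c₂∉) (pendant′-inside at-c))

      free : ∀ {t d} → t ∈ D → S ⊢ t ~ d → Free t d
      free (here refl) td with cover-y td
      ... | inj₁ refl        = free-ya
      ... | inj₂ (inj₁ refl) = free-yb
      ... | inj₂ (inj₂ refl) = free-yc
      free (there (here refl)) td with cover-a td
      ... | inj₁ refl = clashFree-sym S _ _ free-ya
      ... | inj₂ refl = free-aa₂
      free (there (there (here refl))) td with cover-b td
      ... | inj₁ refl = clashFree-sym S _ _ free-yb
      ... | inj₂ refl = free-bb₂
      free (there (there (there (here refl)))) td with cover-c td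
      ... | inj₁ refl = clashFree-sym S _ _ free-yc
      ... | inj₂ refl = free-cc₂
      free (there (there (there (there (here refl))))) td with cover-a₂ td
      ... | inj₁ refl = clashFree-sym S _ _ free-aa₂
      ... | inj₂ refl = free-a₂a₃
      free (there (there (there (there (there (here refl)))))) td with cover-b₂ td
      ... | inj₁ refl = clashFree-sym S _ _ free-bb₂
      ... | inj₂ refl = free-b₂b₃

-- Discharging for 4 colors

module Sparsest (G : Graph) (subcubic : Subcubic G) where

  open Graph G
  open Induced G
  open Subcubic-induced G subcubic
  open Sparse G subcubic
  open Pendant G subcubic
  open Pendant-reductions G subcubic
  open Spider G subcubic

  empty-pendant : ∀ S → (∀ v → v ∉ˢ S) → PendantColoring S
  empty-pendant S empty = record
    { color     = λ _ _ → 0F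
    ; color-sym = λ _ _ → refl
    ; pendant   = λ _ → 0F
    ; valid     = λ bc → contradiction (proj₁ bc) (empty _)
    }

  4-colorable : mad G < + 7 / 3 → χ′inj G ≤ 4
  -- The bound 7/3 is written as 14/6, so that charges in units of 1/6 are integers.
  4-colorable mad<7/3 = colorable 14 6 mad<7/3 PendantColoring pendant⇒proper empty-pendant dense
    where
    module _ (S : Subset n) (smaller : ∀ {S′} → S′ ⊂ S → ¬ ¬ PendantColoring S′)
             (¬P : ¬ PendantColoring S) where

      irreducible : ∀ v D → v ∈ˢ S → ¬ (PendantColoring (S ∖ (v ∷ D)) → PendantColoring S)
      irreducible v D v∈ reduce = smaller (∖-⊂ (v ∷ D) v∈ (here refl)) (¬P ∘ reduce)

      no-≤1-vertex : ∀ {v} → v ∈ˢ S → ¬ deg S v ≤ 1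
      no-≤1-vertex {v} v∈ deg≤1 with few-neighbors S v (ℕ.m≤n⇒m≤1+n deg≤1)
      ... | inj₁ none                        = irreducible v [] v∈ (restore-isolated none)
      ... | inj₂ (inj₁ (u , vu , _ , cover)) = irreducible v [] v∈ (restore-leaf vu cover)
      ... | inj₂ (inj₂ (_ , _ , deg≡2))      = case subst (_≤ 1) deg≡2 deg≤1 of λ { (s≤s ()) }

      no-triangle : ∀ {u v w} → S ⊢ u ~ v → S ⊢ u ~ w → S ⊢ v ~ w → deg S v ≡ 2 → deg S w ≢ 2
      no-triangle {u} {v} {w} uv uw vw degv degw = irreducible u (v ∷ w ∷ []) (proj₁ uv)
        (restore-triangle uv uw vw degv degw (neighbor-2-or-3 no-≤1-vertex (~-sym uv)))

      no-path : ∀ {u v w} → S ⊢ u ~ v → S ⊢ v ~ w → u ≢ w → deg S u ≡ 2 → deg S v ≡ 2 → deg S w ≢ 2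
      no-path {u} {v} {w} uv vw u≢w degu degv degw = irreducible u (v ∷ w ∷ []) (proj₁ uv)
        (restore-path uv vw u≢w (λ uw → no-triangle (~-sym uv) vw uw degu degw) degu degv degw)

      twos : Vertex → ℕ
      twos v = weight (N S v) (λ u → two (deg S u))

      -- A 2-vertex starts with 6 * 2 - 14 = -2. The factor `suc (twos u)` is the number of
      -- 2-vertices in the chain entered at `u`: a lone 2-vertex gets 1 from each end, and in a
      -- chain of two each gets 2 from its own 3-neighbor.
      charge : Vertex → Vertex → ℕ
      charge v u = three (deg S v) * (two (deg S u) * suc (twos u))

      twos≡ : ∀ {v a b i j} → N S v ≡ a ∷ b ∷ [] → deg S a ≡ i → deg S b ≡ j →
              twos v ≡ two i + (two j + 0)
      twos≡ N≡ refl refl = cong (λ xs → weight xs (λ u → two (deg S u))) N≡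

      charge≡ : ∀ {v u i j t} → deg S v ≡ i → deg S u ≡ j → twos u ≡ t →
                charge v u ≡ three i * (two j * suc t)
      charge≡ refl refl refl = refl

      -- The index is the charge that the 3-vertex `y` pays to `x`; `long` keeps the second
      -- 2-vertex, which is needed to build a spider.
      data Branch (y x : Vertex) : ℕ → Set where
        none  : Branch y x 0
        short : deg S x ≡ 2 → Branch y x 1
        long  : ∀ x₂ → deg S x ≡ 2 → S ⊢ x ~ x₂ → x₂ ≢ y → deg S x₂ ≡ 2 → Branch y x 2

      branch≤2 : ∀ {y x k} → Branch y x k → k ≤ 2
      branch≤2 none             = z≤n
      branch≤2 (short _)        = s≤s z≤n
      branch≤2 (long _ _ _ _ _) = ℕ.≤-refl

      degrees-differ : ∀ {u v} → deg S u ≡ 2 → deg S v ≡ 3 → u ≢ v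
      degrees-differ degu degv refl = case trans (sym degu) degv of λ ()

      branch : ∀ {y x} → S ⊢ y ~ x → deg S y ≡ 3 → ∃[ k ] charge y x ≡ k × Branch y x k
      branch {y} {x} yx degy with degree-2-or-3 S no-≤1-vertex x
      ... | outside-S x∉ _ _ = contradiction (proj₁ (proj₂ yx)) x∉
      ... | is-3 _ _ _ _ degx _ _ _ _ _ _ _ = 0 , charge≡ degy degx refl , none
      ... | is-2 a b _ degx N≡ a≢b xa xb
        with neighbor-2-or-3 no-≤1-vertex xa | neighbor-2-or-3 no-≤1-vertex xb
      ...   | inj₁ a2 | inj₁ b2 = contradiction b2 (no-path (~-sym xa) xb a≢b a2 degx)
      ...   | inj₁ a2 | inj₂ b3 =
        2 , charge≡ degy degx (twos≡ N≡ a2 b3) , long a degx xa (degrees-differ a2 degy) a2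
      ...   | inj₂ a3 | inj₁ b2 =
        2 , charge≡ degy degx (twos≡ N≡ a3 b2) , long b degx xb (degrees-differ b2 degy) b2
      ...   | inj₂ a3 | inj₂ b3 =
        1 , charge≡ degy degx (twos≡ N≡ a3 b3) , short degx

      no-spider : ∀ {y a b c} → S ⊢ y ~ a → S ⊢ y ~ b → S ⊢ y ~ c → a ≢ b → a ≢ c → b ≢ c →
                  deg S y ≡ 3 → Branch y a 2 → Branch y b 2 → deg S c ≢ 2
      no-spider {y} {a} {b} {c} ya yb yc a≢b a≢c b≢c degy
        (long a₂ dega aa₂ a₂≢y dega₂) (long b₂ degb bb₂ b₂≢y degb₂) degc =
        irreducible y (a ∷ b ∷ c ∷ a₂ ∷ b₂ ∷ []) (proj₁ ya)
          (restore-spider no-triangle no-path ya yb yc a≢b a≢c b≢c aa₂ bb₂ a₂≢y b₂≢y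
            degy dega degb degc dega₂ degb₂)

      local : ∀ v → 14 * 𝟙 (v ∈ˢ? S) + weight (N S v) (charge v) ≤
                    6 * deg S v + weight (N S v) (λ u → charge u v)
      local v with degree-2-or-3 S no-≤1-vertex v
      ... | outside-S v∉ deg≡0 N≡ = balance₀ 14 6 N≡ (𝟙-no (v ∈ˢ? S) v∉) deg≡0 z≤n
      ... | is-2 a b v∈ deg≡2 N≡ a≢b va vb =
        settle (neighbor-2-or-3 no-≤1-vertex va) (neighbor-2-or-3 no-≤1-vertex vb)
        where
        balanced : ∀ {i j} → deg S a ≡ i → deg S b ≡ j →
          14 * 1 + 0 ≤ 6 * 2 + (three i * (1 * suc (two i + (two j + 0))) +
                               (three j * (1 * suc (two i + (two j + 0))) + 0)) →
          14 * 𝟙 (v ∈ˢ? S) + weight (N S v) (charge v) ≤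
          6 * deg S v + weight (N S v) (λ u → charge u v)
        balanced da db = balance₂ 14 6 N≡ (𝟙-yes (v ∈ˢ? S) v∈) deg≡2
          (charge≡ deg≡2 da refl) (charge≡ deg≡2 db refl)
          (charge≡ da deg≡2 (twos≡ N≡ da db)) (charge≡ db deg≡2 (twos≡ N≡ da db))

        settle : deg S a ≡ 2 ⊎ deg S a ≡ 3 → deg S b ≡ 2 ⊎ deg S b ≡ 3 →
          14 * 𝟙 (v ∈ˢ? S) + weight (N S v) (charge v) ≤
          6 * deg S v + weight (N S v) (λ u → charge u v)
        settle (inj₁ a2) (inj₁ b2) = contradiction b2 (no-path (~-sym va) vb a≢b a2 deg≡2)
        settle (inj₁ a2) (inj₂ b3) = balanced a2 b3 (ℕ.≤ᵇ⇒≤ _ _ _)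
        settle (inj₂ a3) (inj₁ b2) = balanced a3 b2 (ℕ.≤ᵇ⇒≤ _ _ _)
        settle (inj₂ a3) (inj₂ b3) = balanced a3 b3 (ℕ.≤ᵇ⇒≤ _ _ _)
      ... | is-3 a b c v∈ deg≡3 N≡ a≢b a≢c b≢c va vb vc =
        let _ , ca , branch-a = branch va deg≡3
            _ , cb , branch-b = branch vb deg≡3
            _ , cc , branch-c = branch vc deg≡3
        in balance₃ 14 6 N≡ (𝟙-yes (v ∈ˢ? S) v∈) deg≡3 ca cb cc refl refl refl
             -- A 3-vertex has 6 * 3 = 18 and needs 14, so it can pay 4 whatever it receives.
             (ℕ.≤-trans (ℕ.+-monoʳ-≤ 14 (at-most-4 branch-a branch-b branch-c)) (ℕ.m≤m+n 18 _))
        where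
        -- A total above 4 would require two long branches and a 2-vertex on the third, which is a
        -- spider.
        at-most-4 : ∀ {i j k} → Branch v a i → Branch v b j → Branch v c k → i + (j + (k + 0)) ≤ 4
        at-most-4 none b? c? = ℕ.+-mono-≤ (branch≤2 b?) (ℕ.+-mono-≤ (branch≤2 c?) (z≤n {0}))
        at-most-4 a? none c? = ℕ.+-mono-≤ (branch≤2 a?) (ℕ.+-mono-≤ (branch≤2 c?) (z≤n {0}))
        at-most-4 a? b? none = ℕ.+-mono-≤ (branch≤2 a?) (ℕ.+-mono-≤ (branch≤2 b?) (z≤n {0}))
        at-most-4 (short _) (short _) c? = ℕ.+-monoʳ-≤ 2 (ℕ.+-mono-≤ (branch≤2 c?) (z≤n {0}))
        at-most-4 (short _) b? (short _) = ℕ.+-monoʳ-≤ 1 (ℕ.+-mono-≤ (branch≤2 b?) (ℕ.≤-refl {1}))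
        at-most-4 a? (short _) (short _) = ℕ.+-mono-≤ (branch≤2 a?) (ℕ.≤-refl {2})
        at-most-4 (short a2) b?@(long _ _ _ _ _) c?@(long _ _ _ _ _) =
          contradiction a2 (no-spider vb vc va b≢c (a≢b ∘ sym) (a≢c ∘ sym) deg≡3 b? c?)
        at-most-4 a?@(long _ _ _ _ _) (short b2) c?@(long _ _ _ _ _) =
          contradiction b2 (no-spider va vc vb a≢c a≢b (b≢c ∘ sym) deg≡3 a? c?)
        at-most-4 a?@(long _ _ _ _ _) b?@(long _ _ _ _ _) (short c2) =
          contradiction c2 (no-spider va vb vc a≢b a≢c b≢c deg≡3 a? b?)
        at-most-4 a?@(long _ _ _ _ _) b?@(long _ _ _ _ _) (long _ c2 _ _ _) =
          contradiction c2 (no-spider va vb vc a≢b a≢c b≢c deg≡3 a? b?)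

      dense : 14 * ∣ S ∣ ≤ 6 * sum (deg S)
      dense = discharging S 14 6 charge local

theorem1p16 : (G : Graph) → Subcubic G →
    (mad G < + 7 / 3 → χ′inj G ≤ 4) ×
    (mad G < + 8 / 3 → χ′inj G ≤ 6) ×
    (mad G < + 3 / 1 → χ′inj G ≤ 7)
theorem1p16 G subcubic = 4-colorable , 6-colorable , 7-colorable
  where
  open Sparsest G subcubic
  open Sparse G subcubic
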